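{- Let $n \ge 1$ be an integer such that $2n+1$ is a prime, and let $\mathcal{F}$ be the family of all minimum dominating sets of the graph $C_{2n+1}^n$ (the Cartesian product of $n$ copies of the cycle of length $2n+1$). Then every $S \in \mathcal{F}$ has a defining set (with respect to $\mathcal{F}$) of size at most $n!\,2^n$.
   Context: A set $S$ of vertices of a graph is a dominating set if every vertex either lies in $S$ or is adjacent to a vertex of $S$; a minimum dominating set is a dominating set of smallest possible size. For a family $\mathcal{F}$ of sets and $S \in \mathcal{F}$, a set $D \subseteq S$ is a defining set for $(S,\mathcal{F})$ if $S$ is the only member of $\mathcal{F}$ containing $D$. -}

module Defs where

open import Data.Nat using (ℕ; suc; _+_; _*_; _≤_; _%_; _∸_)
open import Data.Fin using (Fin; toℕ)
open import Data.Vec using (Vec; lookup)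
open import Data.List using (List; length)
open import Data.List.Membership.Propositional using (_∈_)
open import Data.List.Relation.Unary.Unique.Propositional using (Unique)
open import Data.Product using (Σ; _×_; ∃)
open import Data.Sum using (_⊎_)
open import Relation.Binary.PropositionalEquality using (_≡_; _≢_)
open import Relation.Nullary using (¬_)
open import Function.Bundles using (_⇔_)

Vertex : ℕ → ℕ → Set
Vertex m d = Vec (Fin m) d

-- adjacency in the cycle C_m (vertices 0..m-1, i ~ i+1 mod m), for m ≥ 1
-- (for m = 0 there are no vertices; we use modulus `suc (m ∸ 1)` only to avoid
--  a NonZero side condition — it equals m whenever Fin m is inhabited)
CycleAdj : {m : ℕ} → Fin m → Fin m → Set
CycleAdj {m} a b = (toℕ b ≡ (toℕ a + 1) % suc (m ∸ 1)) ⊎ (toℕ a ≡ (toℕ b + 1) % suc (m ∸ 1))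

Adj : {m d : ℕ} → Vertex m d → Vertex m d → Set
Adj {m} {d} u v =
  Σ (Fin d) λ i → CycleAdj (lookup u i) (lookup v i)
                  × (∀ j → j ≢ i → lookup u j ≡ lookup v j)

-- a finite set of vertices: a duplicate-free list
VSet : ℕ → ℕ → Set
VSet m d = List (Vertex m d)

_⊆ᵥ_ : {m d : ℕ} → VSet m d → VSet m d → Set
A ⊆ᵥ B = ∀ {v} → v ∈ A → v ∈ B

_≐_ : {m d : ℕ} → VSet m d → VSet m d → Set
A ≐ B = ∀ v → (v ∈ A) ⇔ (v ∈ B)

IsDominating : (m d : ℕ) → VSet m d → Set
IsDominating m d S =
  Unique S × (∀ (v : Vertex m d) → (v ∈ S) ⊎ (Σ (Vertex m d) λ s → s ∈ S × Adj s v))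

IsMinDominating : (m d : ℕ) → VSet m d → Set
IsMinDominating m d S =
  IsDominating m d S × (∀ T → IsDominating m d T → length S ≤ length T)

IsDefiningSet : (m d : ℕ) → VSet m d → VSet m d → Set
IsDefiningSet m d S D =
  Unique D × D ⊆ᵥ S × (∀ T → IsMinDominating m d T → D ⊆ᵥ T → T ≐ S)

{-# OPTIONS --safe #-}

-- Put p = 2n + 1. Comparing with the code {v : v₁ + 2v₂ + ⋯ + n vₙ ≡ 0} shows that the minimum dominating
-- sets are perfect, so the difference g of two of their indicators sums to 0 over every closed ball.
-- For a frequency ξ let h(c) be the sum of g over the hyperplane ξ·v = c. Convolving h with the
-- distribution w of ξ·b over the ball b ∈ {0, ±eᵢ} gives 0. As ℤ[x]/(1 + x + ⋯ + xᵖ⁻¹) is a domain,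
-- h vanishes unless w is constant, that is, unless ξ is a signed permutation of (1, …, n). Radon inversion
-- therefore expresses each value of g as a linear form in the n! 2ⁿ numbers attached to signed permutations
-- (scaling ξ lets us keep only the level c = 1). Among the forms v ↦ g v with v ∈ S, at most n! 2ⁿ of them
-- span all others, and their points form the defining set.

module Submission where

open import Defs
open import Data.Nat as ℕ using (ℕ; zero; suc; _!)
import Data.Nat.Properties as ℕₚ
import Data.Nat.Divisibility as ℕ∣
import Data.Nat.Tactic.RingSolver as ℕ-Solver
open import Data.Nat.Coprimality using (prime⇒coprime; coprime-Bézout)
open import Data.Nat.DivMod using (m%n<n)
open import Data.Nat.GCD using (module Bézout)
open import Data.Nat.Primality using (Prime; euclidsLemma; prime⇒nonTrivial; prime⇒nonZero)
open import Data.Integer using (ℤ; +_; -_; _+_; _-_; _*_; 0ℤ; 1ℤ; ∣_∣; _≤_; _<_; +≤+)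
import Data.Integer.Properties as ℤₚ
open import Data.Integer.DivMod using (_%ℕ_; _/ℕ_; n%ℕd<d; a≡a%ℕn+[a/ℕn]*n)
open import Data.Integer.Divisibility.Signed using (_∣_; divides; _∣?_; ∣ᵤ⇒∣; ∣⇒∣ᵤ; ∣m∣n⇒∣m+n; ∣m⇒∣-m; ∣n⇒∣m*n; ∣m⇒∣m*n)
open import Data.Integer.Tactic.RingSolver using (solve-∀)
open import Algebra.Properties.AbelianGroup ℤₚ.+-0-abelianGroup using (∙-cancelˡ; ∙-cancelʳ)
open import Data.Fin as Fin using (Fin; toℕ; fromℕ<)
import Data.Fin.Properties as Finₚ
open import Data.Vec as Vec using (Vec; []; _∷_; head; tail; lookup; updateAt; zipWith; insertAt; removeAt)
import Data.Vec.Properties as Vecₚ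
open import Data.List using (List; []; _∷_; _++_; map; concatMap; downFrom; length; allFin; filter; deduplicate)
open import Data.List.Properties using (length-downFrom; length-++; length-map; length-tabulate; filter-accept; filter-reject; length-deduplicate)
open import Data.List.Membership.Propositional using (_∈_; find; lose)
open import Data.List.Membership.Propositional.Properties using (∈-downFrom⁻; ∈-downFrom⁺; ∈-map⁺; ∈-concatMap⁺; ∈-allFin; ∈-++⁺ˡ; ∈-++⁺ʳ; ∈-filter⁺; ∈-deduplicate⁺; ∈-deduplicate⁻)
import Data.List.Membership.DecPropositional as DecMembership
import Data.List.Relation.Unary.Unique.DecPropositional.Properties as DecUnique
open import Data.List.Relation.Unary.Any as Any using (here; there)
open import Data.Product using (Σ; _×_; _,_; proj₁; proj₂)
open import Data.Sum using (_⊎_; inj₁; inj₂; [_,_]′)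
open import Data.Empty using (⊥)
open import Function using (_∘_; mk⇔)
open import Relation.Nullary using (¬_; Dec; yes; no; contradiction; ¬?)
open import Relation.Nullary.Decidable using (_⊎-dec_; decidable-stable)
open import Relation.Binary.Definitions using (DecidableEquality)
open import Relation.Binary.PropositionalEquality using (_≡_; _≢_; refl; sym; trans; cong; cong₂; subst; module ≡-Reasoning)

-- Finite sums

∑ : {A : Set} → List A → (A → ℤ) → ℤ
∑ []       f = 0ℤ
∑ (x ∷ xs) f = f x + ∑ xs f

private
  +-interchange : ∀ a b c d → (a + b) + (c + d) ≡ (a + c) + (b + d)
  +-interchange = solve-∀

module _ {A : Set} where

  ∑-cong-∈ : (xs : List A) {f g : A → ℤ} → (∀ x → x ∈ xs → f x ≡ g x) → ∑ xs f ≡ ∑ xs g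
  ∑-cong-∈ []       e = refl
  ∑-cong-∈ (x ∷ xs) e = cong₂ _+_ (e x (here refl)) (∑-cong-∈ xs λ y → e y ∘ there)

  ∑-cong : (xs : List A) {f g : A → ℤ} → (∀ x → f x ≡ g x) → ∑ xs f ≡ ∑ xs g
  ∑-cong xs e = ∑-cong-∈ xs λ x _ → e x

  ∑-const : (xs : List A) (c : ℤ) → ∑ xs (λ _ → c) ≡ + length xs * c
  ∑-const []       c = sym (ℤₚ.*-zeroˡ c)
  ∑-const (x ∷ xs) c = trans (cong (_+_ c) (∑-const xs c)) (sym (ℤₚ.suc-* (+ length xs) c))

  ∑-zero : (xs : List A) {f : A → ℤ} → (∀ x → f x ≡ 0ℤ) → ∑ xs f ≡ 0ℤ
  ∑-zero xs e = trans (∑-cong xs e) (trans (∑-const xs 0ℤ) (ℤₚ.*-zeroʳ (+ length xs)))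

  ∑-+ : (xs : List A) (f g : A → ℤ) → ∑ xs (λ x → f x + g x) ≡ ∑ xs f + ∑ xs g
  ∑-+ []       f g = refl
  ∑-+ (x ∷ xs) f g = trans (cong (_+_ (f x + g x)) (∑-+ xs f g)) (+-interchange (f x) (g x) (∑ xs f) (∑ xs g))

  ∑-- : (xs : List A) (f g : A → ℤ) → ∑ xs (λ x → f x - g x) ≡ ∑ xs f - ∑ xs g
  ∑-- []       f g = refl
  ∑-- (x ∷ xs) f g = trans (cong (_+_ (f x - g x)) (∑-- xs f g)) (lem (f x) (g x) (∑ xs f) (∑ xs g))
    where
    lem : ∀ a b c d → (a - b) + (c - d) ≡ (a + c) - (b + d)
    lem = solve-∀

  ∑-*ˡ : (xs : List A) (c : ℤ) (f : A → ℤ) → ∑ xs (λ x → c * f x) ≡ c * ∑ xs f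
  ∑-*ˡ []       c f = sym (ℤₚ.*-zeroʳ c)
  ∑-*ˡ (x ∷ xs) c f = trans (cong (_+_ (c * f x)) (∑-*ˡ xs c f)) (sym (ℤₚ.*-distribˡ-+ c (f x) (∑ xs f)))

  ∑-*ʳ : (xs : List A) (c : ℤ) (f : A → ℤ) → ∑ xs (λ x → f x * c) ≡ ∑ xs f * c
  ∑-*ʳ xs c f = trans (∑-cong xs λ x → ℤₚ.*-comm (f x) c) (trans (∑-*ˡ xs c f) (ℤₚ.*-comm c (∑ xs f)))

  ∑-++ : (xs ys : List A) (f : A → ℤ) → ∑ (xs ++ ys) f ≡ ∑ xs f + ∑ ys f
  ∑-++ []       ys f = sym (ℤₚ.+-identityˡ _)
  ∑-++ (x ∷ xs) ys f = trans (cong (_+_ (f x)) (∑-++ xs ys f)) (sym (ℤₚ.+-assoc (f x) _ _))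

  ∑-nonneg : (xs : List A) {f : A → ℤ} → (∀ x → 0ℤ ≤ f x) → 0ℤ ≤ ∑ xs f
  ∑-nonneg []       nn = ℤₚ.≤-refl
  ∑-nonneg (x ∷ xs) nn = ℤₚ.+-mono-≤ (nn x) (∑-nonneg xs nn)

  ∑≥term : (xs : List A) {f : A → ℤ} → (∀ x → 0ℤ ≤ f x) → ∀ {x} → x ∈ xs → f x ≤ ∑ xs f
  ∑≥term (x ∷ xs) {f} nn (here refl) = subst (_≤ f x + ∑ xs f) (ℤₚ.+-identityʳ (f x)) (ℤₚ.+-monoʳ-≤ (f x) (∑-nonneg xs nn))
  ∑≥term (x ∷ xs) {f} nn {y} (there m) = subst (_≤ f x + ∑ xs f) (ℤₚ.+-identityˡ (f y)) (ℤₚ.+-mono-≤ (nn x) (∑≥term xs nn m))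

  ∑≤0⇒≡0 : (xs : List A) {f : A → ℤ} → (∀ x → 0ℤ ≤ f x) → ∑ xs f ≤ 0ℤ → ∀ {x} → x ∈ xs → f x ≡ 0ℤ
  ∑≤0⇒≡0 xs nn le m = ℤₚ.≤-antisym (ℤₚ.≤-trans (∑≥term xs nn m) le) (nn _)

module _ {A B : Set} where

  ∑-swap : (xs : List A) (ys : List B) (f : A → B → ℤ) →
           ∑ xs (λ x → ∑ ys (f x)) ≡ ∑ ys (λ y → ∑ xs (λ x → f x y))
  ∑-swap []       ys f = sym (∑-zero ys λ _ → refl)
  ∑-swap (x ∷ xs) ys f = trans (cong (_+_ (∑ ys (f x))) (∑-swap xs ys f)) (sym (∑-+ ys (f x) _))

  ∑-map : (h : A → B) (xs : List A) (f : B → ℤ) → ∑ (map h xs) f ≡ ∑ xs (f ∘ h)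
  ∑-map h []       f = refl
  ∑-map h (x ∷ xs) f = cong (_+_ (f (h x))) (∑-map h xs f)

  ∑-concatMap : (h : A → List B) (xs : List A) (f : B → ℤ) →
                ∑ (concatMap h xs) f ≡ ∑ xs (λ x → ∑ (h x) f)
  ∑-concatMap h []       f = refl
  ∑-concatMap h (x ∷ xs) f = trans (∑-++ (h x) (concatMap h xs) f) (cong (_+_ (∑ (h x) f)) (∑-concatMap h xs f))

∑< : ℕ → (ℕ → ℤ) → ℤ
∑< n = ∑ (downFrom n)

∑<-suc : ∀ n f → ∑< n (f ∘ suc) + f 0 ≡ ∑< (suc n) f
∑<-suc zero    f = ℤₚ.+-comm 0ℤ (f 0)
∑<-suc (suc n) f = trans (ℤₚ.+-assoc (f (suc n)) _ _) (cong (_+_ (f (suc n))) (∑<-suc n f))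

∑<-single : ∀ n f a → a ℕ.< n → (∀ b → b ℕ.< n → b ≢ a → f b ≡ 0ℤ) → ∑< n f ≡ f a
∑<-single (suc n) f a a<n e with n ℕ.≟ a
... | yes refl = trans (cong (_+_ (f n))
  (trans (∑-cong-∈ (downFrom n) λ b m → e b (ℕₚ.m<n⇒m<1+n (∈-downFrom⁻ m)) (ℕₚ.<⇒≢ (∈-downFrom⁻ m)))
  (∑-zero (downFrom n) λ _ → refl))) (ℤₚ.+-identityʳ (f n))
... | no n≢a = trans (cong (_+ ∑< n f) (e n (ℕₚ.n<1+n n) n≢a))
  (trans (ℤₚ.+-identityˡ _) (∑<-single n f a (ℕₚ.≤∧≢⇒< (ℕₚ.≤-pred a<n) (n≢a ∘ sym)) λ b b<n → e b (ℕₚ.m<n⇒m<1+n b<n)))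

-- Finite differences and Newton's forward formula

Δ : (ℕ → ℤ) → ℕ → ℤ
Δ f a = f (suc a) - f a

Δ^ : ℕ → (ℕ → ℤ) → ℕ → ℤ
Δ^ zero    f = f
Δ^ (suc k) f = Δ^ k (Δ f)

Δ^-cong : ∀ k {f g} → (∀ a → f a ≡ g a) → ∀ a → Δ^ k f a ≡ Δ^ k g a
Δ^-cong zero    e a = e a
Δ^-cong (suc k) e a = Δ^-cong k (λ b → cong₂ _-_ (e (suc b)) (e b)) a

Δ^-Δ : ∀ k f a → Δ (Δ^ k f) a ≡ Δ^ (suc k) f a
Δ^-Δ zero    f a = refl
Δ^-Δ (suc k) f a = Δ^-Δ k (Δ f) a

Δ^-zero : ∀ k {f} → (∀ a → f a ≡ 0ℤ) → ∀ a → Δ^ k f a ≡ 0ℤ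
Δ^-zero zero    e a = e a
Δ^-zero (suc k) e a = Δ^-zero k (λ b → cong₂ _-_ (e (suc b)) (e b)) a

Δ-const⇒linear : ∀ {f K} → (∀ a → Δ f a ≡ K) → ∀ a → f a ≡ f 0 + + a * K
Δ-const⇒linear {f} {K} e zero = sym (trans (cong (_+_ (f 0)) (ℤₚ.*-zeroˡ K)) (ℤₚ.+-identityʳ (f 0)))
Δ-const⇒linear {f} {K} e (suc a) = begin
  f (suc a)                    ≡⟨ lem (f (suc a)) (f a) ⟩
  Δ f a + f a                  ≡⟨ cong₂ _+_ (e a) (Δ-const⇒linear {f} {K} e a) ⟩
  K + (f 0 + + a * K)          ≡⟨ lem′ K (f 0) (+ a) ⟩
  f 0 + (1ℤ + + a) * K         ∎
  where
  open ≡-Reasoning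
  lem : ∀ x y → x ≡ x - y + y
  lem = solve-∀
  lem′ : ∀ x y z → x + (y + z * x) ≡ y + (1ℤ + z) * x
  lem′ = solve-∀

binom : ℕ → ℕ → ℤ
binom n       zero    = 1ℤ
binom zero    (suc k) = 0ℤ
binom (suc n) (suc k) = binom n k + binom n (suc k)

binom-absorb : ∀ n k → + suc k * binom (suc n) (suc k) ≡ + suc n * binom n k
binom-absorb zero zero = refl
binom-absorb zero (suc k) = ℤₚ.*-zeroʳ (+ suc (suc k))
binom-absorb (suc n) zero = begin
  + 1 * (1ℤ + binom (suc n) 1)    ≡⟨ lem (binom (suc n) 1) ⟩
  1ℤ + + 1 * binom (suc n) 1      ≡⟨ cong (_+_ 1ℤ) (binom-absorb n zero) ⟩
  1ℤ + + suc n * 1ℤ               ≡⟨ lem′ (+ suc n) ⟩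
  (1ℤ + + suc n) * 1ℤ             ∎
  where
  open ≡-Reasoning
  lem : ∀ x → 1ℤ * (1ℤ + x) ≡ 1ℤ + 1ℤ * x
  lem = solve-∀
  lem′ : ∀ x → 1ℤ + x * 1ℤ ≡ (1ℤ + x) * 1ℤ
  lem′ = solve-∀
binom-absorb (suc n) (suc k) = begin
  (1ℤ + + suc k) * (B + C)                  ≡⟨ lem (+ suc k) B C ⟩
  B + + suc k * B + (1ℤ + + suc k) * C      ≡⟨ cong₂ (λ x y → B + x + y) (binom-absorb n k) (binom-absorb n (suc k)) ⟩
  B + + suc n * binom n k + + suc n * binom n (suc k) ≡⟨ lem′ (+ suc n) (binom n k) (binom n (suc k)) ⟩
  (1ℤ + + suc n) * B ∎
  where
  open ≡-Reasoning
  B = binom (suc n) (suc k)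
  C = binom (suc n) (suc (suc k))
  lem : ∀ k B C → (1ℤ + k) * (B + C) ≡ B + k * B + (1ℤ + k) * C
  lem = solve-∀
  lem′ : ∀ n x y → (x + y) + n * x + n * y ≡ (1ℤ + n) * (x + y)
  lem′ = solve-∀

binom-over : ∀ n k → n ℕ.< k → binom n k ≡ 0ℤ
binom-over zero    (suc k) _ = refl
binom-over (suc n) (suc k) (ℕ.s≤s lt) = cong₂ _+_ (binom-over n k lt) (binom-over n (suc k) (ℕₚ.m<n⇒m<1+n lt))

binom-diag : ∀ n → binom n n ≡ 1ℤ
binom-diag zero    = refl
binom-diag (suc n) = cong₂ _+_ (binom-diag n) (binom-over n (suc n) (ℕₚ.n<1+n n))

binom-pascal-∑ : ∀ m n (φ : ℕ → ℤ) →
  ∑< (suc m) (λ j → binom (suc n) j * φ j) ≡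
  ∑< (suc m) (λ j → binom n j * φ j) + ∑< m (λ j → binom n j * φ (suc j))
binom-pascal-∑ zero    n φ = sym (ℤₚ.+-identityʳ _)
binom-pascal-∑ (suc m) n φ = trans (cong (_+_ (binom (suc n) (suc m) * φ (suc m))) (binom-pascal-∑ m n φ))
  (lem (binom n m) (binom n (suc m)) (φ (suc m)) (∑< (suc m) λ j → binom n j * φ j) (∑< m λ j → binom n j * φ (suc j)))
  where
  lem : ∀ a b c x y → (a + b) * c + (x + y) ≡ (b * c + x) + (a * c + y)
  lem = solve-∀

newton : ∀ k f x → f (k ℕ.+ x) ≡ ∑< (suc k) (λ j → binom k j * Δ^ j f x)
newton zero f x = lem (f x)
  where
  lem : ∀ a → a ≡ 1ℤ * a + 0ℤ
  lem = solve-∀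
newton (suc k) f x = begin
  f (suc (k ℕ.+ x))                                      ≡⟨ lem (f (suc (k ℕ.+ x))) (f (k ℕ.+ x)) ⟩
  f (k ℕ.+ x) + Δ f (k ℕ.+ x)                            ≡⟨ cong₂ _+_ (newton k f x) (newton k (Δ f) x) ⟩
  P + R                                                  ≡⟨ cong (_+ R) (ℤₚ.+-identityˡ P) ⟨
  0ℤ + P + R                                             ≡⟨ cong (λ z → z + P + R)
                                                              (trans (cong (_* φ (suc k)) (binom-over k (suc k)
                                                                (ℕₚ.n<1+n k))) (ℤₚ.*-zeroˡ (φ (suc k)))) ⟨
  ∑< (suc (suc k)) (λ j → binom k j * φ j) + R           ≡⟨ binom-pascal-∑ (suc k) k φ ⟨
  ∑< (suc (suc k)) (λ j → binom (suc k) j * φ j)         ∎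
  where
  open ≡-Reasoning
  φ : ℕ → ℤ
  φ j = Δ^ j f x
  P = ∑< (suc k) (λ j → binom k j * φ j)
  R = ∑< (suc k) (λ j → binom k j * φ (suc j))
  lem : ∀ a b → a ≡ b + (a - b)
  lem = solve-∀

-- Linear forms and elimination

_·_ : ∀ {n} → Vec ℤ n → Vec ℤ n → ℤ
[]      · []      = 0ℤ
(x ∷ r) · (y ∷ s) = x * y + r · s

·-zeroˡ : ∀ {n} (y : Vec ℤ n) → Vec.replicate n 0ℤ · y ≡ 0ℤ
·-zeroˡ []      = refl
·-zeroˡ (y ∷ s) = cong₂ _+_ (ℤₚ.*-zeroˡ y) (·-zeroˡ s)

·-combine : ∀ {n} a b (r s y : Vec ℤ n) → zipWith (λ t u → a * t + b * u) r s · y ≡ a * (r · y) + b * (s · y)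
·-combine a b []      []      []      = sym (cong₂ _+_ (ℤₚ.*-zeroʳ a) (ℤₚ.*-zeroʳ b))
·-combine a b (x ∷ r) (z ∷ s) (y ∷ t) = trans (cong (_+_ ((a * x + b * z) * y)) (·-combine a b r s t))
  (lem a b x z y (r · t) (s · t))
  where
  lem : ∀ a b x z y R S → (a * x + b * z) * y + (a * R + b * S) ≡ a * (x * y + R) + b * (z * y + S)
  lem = solve-∀

·-∷ : ∀ {n} (r : Vec ℤ (suc n)) y s → r · (y ∷ s) ≡ head r * y + tail r · s
·-∷ (x ∷ r) y s = refl

basis : ∀ {A : Set} {x : A} {xs} → x ∈ xs → Vec ℤ (length xs)
basis {xs = _ ∷ xs} (here _)  = 1ℤ ∷ Vec.replicate (length xs) 0ℤ
basis {xs = _ ∷ xs} (there m) = 0ℤ ∷ basis m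

·-basis : ∀ {A : Set} (f : A → ℤ) {x xs} (m : x ∈ xs) → basis m · Vec.map f (Vec.fromList xs) ≡ f x
·-basis f {xs = x ∷ xs} (here refl) = trans (cong₂ _+_ (ℤₚ.*-identityˡ (f x)) (·-zeroˡ (Vec.map f (Vec.fromList xs))))
  (ℤₚ.+-identityʳ (f x))
·-basis f {y} {x ∷ xs} (there m) = trans (cong₂ _+_ (ℤₚ.*-zeroˡ (f x)) (·-basis f m)) (ℤₚ.+-identityˡ (f y))

record SpanningRows {A : Set} (xs : List A) {n : ℕ} (r : A → Vec ℤ n) : Set where
  field
    rows   : List A
    rows⊆  : ∀ {x} → x ∈ rows → x ∈ xs
    #rows≤ : length rows ℕ.≤ n
    spans  : ∀ y → (∀ {x} → x ∈ rows → r x · y ≡ 0ℤ) → ∀ {x} → x ∈ xs → r x · y ≡ 0ℤ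

spanning-rows : ∀ {A : Set} n (xs : List A) (r : A → Vec ℤ n) → SpanningRows xs r
spanning-rows zero xs r = record { rows = [] ; rows⊆ = λ () ; #rows≤ = ℕ.z≤n ; spans = λ { [] _ {x} _ → empty (r x) } }
  where
  empty : (v : Vec ℤ 0) → v · [] ≡ 0ℤ
  empty [] = refl
spanning-rows {A} (suc n) xs r with Any.any? (λ x → ¬? (head (r x) ℤₚ.≟ 0ℤ)) xs
... | no none = reduce (spanning-rows n xs (tail ∘ r))
  where
  drop-head : ∀ {x} → x ∈ xs → ∀ y s → r x · (y ∷ s) ≡ tail (r x) · s
  drop-head {x} x∈ y s = trans (·-∷ (r x) y s) (trans (cong (λ t → t * y + tail (r x) · s)
    (decidable-stable (head (r x) ℤₚ.≟ 0ℤ) λ h≢0 → none (lose x∈ h≢0)))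
    (trans (cong (_+ tail (r x) · s) (ℤₚ.*-zeroˡ y)) (ℤₚ.+-identityˡ (tail (r x) · s))))
  reduce : SpanningRows xs (tail ∘ r) → SpanningRows xs r
  reduce R = record { rows = rows ; rows⊆ = rows⊆ ; #rows≤ = ℕₚ.m≤n⇒m≤1+n #rows≤ ; spans = λ { (y ∷ s) vanish x∈ →
    trans (drop-head x∈ y s) (spans s (λ d∈ → trans (sym (drop-head (rows⊆ d∈) y s)) (vanish d∈)) x∈) } }
    where open SpanningRows R
... | yes some = eliminate (find some)
  where
  eliminate : (Σ A λ p → p ∈ xs × head (r p) ≢ 0ℤ) → SpanningRows xs r
  eliminate (p , p∈ , a≢0) = extend (spanning-rows n xs r₁)
    where
    a : ℤ
    a = head (r p)
    r₁ : A → Vec ℤ n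
    r₁ x = zipWith (λ t u → a * t + - head (r x) * u) (tail (r x)) (tail (r p))
    r₁-eq : ∀ x y s → r₁ x · s ≡ a * (r x · (y ∷ s)) + - head (r x) * (r p · (y ∷ s))
    r₁-eq x y s = trans (·-combine a (- head (r x)) (tail (r x)) (tail (r p)) s)
      (trans (lem a (head (r x)) (tail (r x) · s) (tail (r p) · s) y)
      (sym (cong₂ (λ t u → a * t + - head (r x) * u) (·-∷ (r x) y s) (·-∷ (r p) y s))))
      where
      lem : ∀ a b R S y → a * R + - b * S ≡ a * (b * y + R) + - b * (a * y + S)
      lem = solve-∀
    r₁-0 : ∀ x y s → r p · (y ∷ s) ≡ 0ℤ → r₁ x · s ≡ a * (r x · (y ∷ s))
    r₁-0 x y s e = trans (r₁-eq x y s) (trans (cong (λ t → a * (r x · (y ∷ s)) + - head (r x) * t) e)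
      (trans (cong (_+_ (a * (r x · (y ∷ s)))) (ℤₚ.*-zeroʳ (- head (r x)))) (ℤₚ.+-identityʳ (a * (r x · (y ∷ s))))))
    cancel : ∀ z → a * z ≡ 0ℤ → z ≡ 0ℤ
    cancel z e with ℤₚ.i*j≡0⇒i≡0∨j≡0 a e
    ... | inj₁ a≡0 = contradiction a≡0 a≢0
    ... | inj₂ z≡0 = z≡0
    extend : SpanningRows xs r₁ → SpanningRows xs r
    extend R = record { rows = p ∷ rows ; rows⊆ = λ { (here refl) → p∈ ;
      (there d∈) → rows⊆ d∈ } ; #rows≤ = ℕ.s≤s #rows≤ ; spans = λ { (y ∷ s) vanish {x} x∈ →
      cancel (r x · (y ∷ s)) (trans (sym (r₁-0 x y s (vanish (here refl))))
        (spans s (λ {d} d∈ → trans (r₁-0 d y s (vanish (here refl)))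
          (trans (cong (a *_) (vanish (there d∈))) (ℤₚ.*-zeroʳ a))) x∈)) } }
      where open SpanningRows R

-- Integers modulo p and periodic sequences

module PrimeModulus (p : ℕ) (p-prime : Prime p) where

  instance
    p-nonZero : ℕ.NonZero p
    p-nonZero = prime⇒nonZero p-prime

  infix 4 _≈_

  record _≈_ (x y : ℤ) : Set where
    constructor mod-p
    field ≈⇒∣ : + p ∣ x - y
  open _≈_ public

  ≈-reflexive : ∀ {x y} → x ≡ y → x ≈ y
  ≈-reflexive {x} refl = mod-p (divides 0ℤ (ℤₚ.+-inverseʳ x))

  ≈-refl : ∀ {x} → x ≈ x
  ≈-refl = ≈-reflexive refl

  ≈-sym : ∀ {x y} → x ≈ y → y ≈ x
  ≈-sym {x} {y} (mod-p d) = mod-p (subst (+ p ∣_) (lem x y) (∣m⇒∣-m d))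
    where
    lem : ∀ x y → - (x - y) ≡ y - x
    lem = solve-∀

  ≈-trans : ∀ {x y z} → x ≈ y → y ≈ z → x ≈ z
  ≈-trans {x} {y} {z} (mod-p d) (mod-p e) = mod-p (subst (+ p ∣_) (lem x y z) (∣m∣n⇒∣m+n d e))
    where
    lem : ∀ x y z → (x - y) + (y - z) ≡ x - z
    lem = solve-∀

  +-cong-≈ : ∀ {a b c d} → a ≈ b → c ≈ d → a + c ≈ b + d
  +-cong-≈ {a} {b} {c} {d} (mod-p e) (mod-p f) = mod-p (subst (+ p ∣_) (lem a b c d) (∣m∣n⇒∣m+n e f))
    where
    lem : ∀ a b c d → (a - b) + (c - d) ≡ (a + c) - (b + d)
    lem = solve-∀

  *-congˡ-≈ : ∀ a {c d} → c ≈ d → a * c ≈ a * d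
  *-congˡ-≈ a {c} {d} (mod-p e) = mod-p (subst (+ p ∣_) (lem a c d) (∣n⇒∣m*n a e))
    where
    lem : ∀ a c d → a * (c - d) ≡ a * c - a * d
    lem = solve-∀

  *-congʳ-≈ : ∀ {c d} a → c ≈ d → c * a ≈ d * a
  *-congʳ-≈ {c} {d} a (mod-p e) = mod-p (subst (+ p ∣_) (lem a c d) (∣m⇒∣m*n a e))
    where
    lem : ∀ a c d → (c - d) * a ≡ c * a - d * a
    lem = solve-∀

  neg-cong-≈ : ∀ {c d} → c ≈ d → - c ≈ - d
  neg-cong-≈ {c} {d} (mod-p e) = mod-p (subst (+ p ∣_) (lem c d) (∣m⇒∣-m e))
    where
    lem : ∀ c d → - (c - d) ≡ - c - - d
    lem = solve-∀

  ∣⇒≈0 : ∀ {x} → + p ∣ x → x ≈ 0ℤ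
  ∣⇒≈0 {x} d = mod-p (subst (+ p ∣_) (sym (ℤₚ.+-identityʳ x)) d)

  ≈0⇒∣ : ∀ {x} → x ≈ 0ℤ → + p ∣ x
  ≈0⇒∣ {x} (mod-p d) = subst (+ p ∣_) (ℤₚ.+-identityʳ x) d

  ∑-cong-≈ : {A : Set} (xs : List A) {f g : A → ℤ} → (∀ x → f x ≈ g x) → ∑ xs f ≈ ∑ xs g
  ∑-cong-≈ []       e = ≈-refl
  ∑-cong-≈ (x ∷ xs) e = +-cong-≈ (e x) (∑-cong-≈ xs e)

  ∑-≈0 : {A : Set} (xs : List A) {f : A → ℤ} → (∀ x → x ∈ xs → f x ≈ 0ℤ) → ∑ xs f ≈ 0ℤ
  ∑-≈0 []       e = ≈-refl
  ∑-≈0 (x ∷ xs) e = +-cong-≈ (e x (here refl)) (∑-≈0 xs λ y → e y ∘ there)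

  p∤small : ∀ {a} → 0 ℕ.< a → a ℕ.< p → ¬ + p ∣ + a
  p∤small {suc a} _ a<p d = ℕₚ.<⇒≱ a<p (ℕ∣.∣⇒≤ (∣⇒∣ᵤ d))

  ∣x∣<p⇒≡0 : ∀ {x} → ∣ x ∣ ℕ.< p → + p ∣ x → x ≡ 0ℤ
  ∣x∣<p⇒≡0 {x} lt d = ℤₚ.∣i∣≡0⇒i≡0 (go ∣ x ∣ lt (∣⇒∣ᵤ d))
    where
    go : ∀ a → a ℕ.< p → p ℕ∣.∣ a → a ≡ 0
    go zero    _   _  = refl
    go (suc a) a<p d′ = contradiction (ℕ∣.∣⇒≤ d′) (ℕₚ.<⇒≱ a<p)

  p*x≡0⇒x≡0 : ∀ x → + p * x ≡ 0ℤ → x ≡ 0ℤ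
  p*x≡0⇒x≡0 x e with ℤₚ.i*j≡0⇒i≡0∨j≡0 (+ p) e
  ... | inj₁ p≡0 = contradiction (ℤₚ.+-injective p≡0) (ℕ.≢-nonZero⁻¹ p)
  ... | inj₂ x≡0 = x≡0

  Periodic : (ℕ → ℤ) → Set
  Periodic f = ∀ a → f (a ℕ.+ p) ≡ f a

  ∑<-shift : ∀ f → Periodic f → ∑< p (f ∘ suc) ≡ ∑< p f
  ∑<-shift f per = ∙-cancelʳ (f 0) (∑< p (f ∘ suc)) (∑< p f)
    (trans (∑<-suc p f) (trans (cong (_+ ∑< p f) (per 0)) (ℤₚ.+-comm (f 0) (∑< p f))))

  ∑<-shift-+ : ∀ f → Periodic f → ∀ c → ∑< p (λ a → f (c ℕ.+ a)) ≡ ∑< p f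
  ∑<-shift-+ f per zero = refl
  ∑<-shift-+ f per (suc c) = trans (∑<-shift-+ (f ∘ suc) (per ∘ suc) c) (∑<-shift f per)

  p∣*⇒ : ∀ x y → + p ∣ x * y → (+ p ∣ x) ⊎ (+ p ∣ y)
  p∣*⇒ x y d with euclidsLemma ∣ x ∣ ∣ y ∣ p-prime (subst (p ℕ∣.∣_) (ℤₚ.abs-* x y) (∣⇒∣ᵤ d))
  ... | inj₁ e = inj₁ (∣ᵤ⇒∣ e)
  ... | inj₂ e = inj₂ (∣ᵤ⇒∣ e)

  p∣binom : ∀ q → p ≡ suc q → ∀ k → suc k ℕ.< p → + p ∣ binom p (suc k)
  p∣binom q refl k lt with p∣*⇒ (+ suc k) (binom p (suc k))
    (divides (binom q k) (trans (binom-absorb q k) (ℤₚ.*-comm (+ p) (binom q k))))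
  ... | inj₁ d = contradiction d (p∤small (ℕ.s≤s ℕ.z≤n) lt)
  ... | inj₂ d = d

  Δ^p≈0 : ∀ f → Periodic f → ∀ x → Δ^ p f x ≈ 0ℤ
  Δ^p≈0 f per x = Δ^1+q≈0 (ℕ.pred p) (sym (ℕₚ.suc-pred p))
    where
    Δ^1+q≈0 : ∀ q → p ≡ suc q → Δ^ p f x ≈ 0ℤ
    Δ^1+q≈0 q refl = ≈-trans (≈-reflexive (lem (f x) (Δ^ p f x)))
      (≈-trans (+-cong-≈ (≈-sym expand) (≈-refl {x = - f x})) (≈-reflexive (ℤₚ.+-inverseʳ (f x))))
      where
      lem : ∀ a b → b ≡ (a + b) - a
      lem = solve-∀
      t : ℕ → ℤ
      t j = binom p j * Δ^ j f x
      middle : ∑< q (t ∘ suc) ≈ 0ℤ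
      middle = ∑-≈0 (downFrom q) λ j j∈ → ∣⇒≈0 (∣m⇒∣m*n (Δ^ (suc j) f x) (p∣binom q refl j (ℕ.s≤s (∈-downFrom⁻ j∈))))
      lem′ : ∀ a b → 1ℤ * b + (0ℤ + 1ℤ * a) ≡ a + b
      lem′ = solve-∀
      expand : f x ≈ f x + Δ^ p f x
      expand = ≈-trans (≈-reflexive (trans (sym (per x)) (trans (cong f (ℕₚ.+-comm x p)) (newton p f x))))
              (≈-trans (≈-reflexive (cong₂ _+_ (cong (_* Δ^ p f x) (binom-diag p)) (sym (∑<-suc q t))))
              (≈-trans (+-cong-≈ (≈-refl {x = 1ℤ * Δ^ p f x}) (+-cong-≈ middle (≈-refl {x = 1ℤ * f x})))
                       (≈-reflexive (lem′ (f x) (Δ^ p f x)))))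

  corr : (ℕ → ℤ) → (ℕ → ℤ) → ℕ → ℤ
  corr w h c = ∑< p λ a → w a * h (c ℕ.+ a)

  corr-periodic : ∀ w h → Periodic h → Periodic (corr w h)
  corr-periodic w h per c = ∑-cong (downFrom p) λ a → cong (w a *_)
    (trans (cong h (trans (ℕₚ.+-assoc c p a) (trans (cong (c ℕ.+_) (ℕₚ.+-comm p a)) (sym (ℕₚ.+-assoc c a p)))))
    (per (c ℕ.+ a)))

  corr-Δ : ∀ w h c → corr w (Δ h) c ≡ Δ (corr w h) c
  corr-Δ w h c = trans (∑-cong (downFrom p) λ a → lem (w a) (h (suc (c ℕ.+ a))) (h (c ℕ.+ a)))
    (∑-- (downFrom p) (λ a → w a * h (suc c ℕ.+ a)) (λ a → w a * h (c ℕ.+ a)))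
    where
    lem : ∀ a b c → a * (b - c) ≡ a * b - a * c
    lem = solve-∀

  corr-Δ^ : ∀ k w h c → corr w (Δ^ k h) c ≡ Δ^ k (corr w h) c
  corr-Δ^ zero    w h c = refl
  corr-Δ^ (suc k) w h c = trans (corr-Δ^ k w (Δ h) c) (Δ^-cong k (corr-Δ w h) c)

  Constant : (ℕ → ℤ) → Set
  Constant f = ∀ c → Δ f c ≡ 0ℤ

  Δ≈0⇒≈ : ∀ f → (∀ a → Δ f a ≈ 0ℤ) → ∀ a c → f (c ℕ.+ a) ≈ f c
  Δ≈0⇒≈ f e zero    c = ≈-reflexive (cong f (ℕₚ.+-identityʳ c))
  Δ≈0⇒≈ f e (suc a) c = ≈-trans (≈-reflexive (trans (cong f (ℕₚ.+-suc c a)) (lem (f (suc (c ℕ.+ a))) (f (c ℕ.+ a)))))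
                           (≈-trans (+-cong-≈ (e (c ℕ.+ a)) (Δ≈0⇒≈ f e a c)) (≈-reflexive (ℤₚ.+-identityˡ (f c))))
    where
    lem : ∀ x y → x ≡ x - y + y
    lem = solve-∀

  -- An element of augmentation prime to p acts invertibly modulo p, because Δ is nilpotent modulo p.
  constant-mod-p : ∀ w h → ¬ + p ∣ ∑< p w → Periodic h → Constant (corr w h) → ∀ a → Δ h a ≈ 0ℤ
  constant-mod-p w h ndiv per const = down (ℕ.pred p)
    (λ a → subst (λ m → Δ^ m h a ≈ 0ℤ) (sym (ℕₚ.suc-pred p)) (Δ^p≈0 h per a))
    where
    down : ∀ k → (∀ a → Δ^ (suc k) h a ≈ 0ℤ) → ∀ a → Δ h a ≈ 0ℤ
    down zero    e = e
    down (suc k) e = down k λ a → ∣⇒≈0 (divF a)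
      where
      F = Δ^ (suc k) h
      ΔF≈0 : ∀ a → Δ F a ≈ 0ℤ
      ΔF≈0 a = ≈-trans (≈-reflexive (Δ^-Δ (suc k) h a)) (e a)
      corr≈ : ∀ a → corr w F a ≈ ∑< p w * F a
      corr≈ a = ≈-trans (∑-cong-≈ (downFrom p) λ b → *-congˡ-≈ (w b) (Δ≈0⇒≈ F ΔF≈0 b a))
        (≈-reflexive (∑-*ʳ (downFrom p) (F a) w))
      corr≡0 : ∀ a → corr w F a ≡ 0ℤ
      corr≡0 a = trans (corr-Δ^ (suc k) w h a) (Δ^-zero k const a)
      divF : ∀ a → + p ∣ F a
      divF a = [ (λ d → contradiction d ndiv) , (λ d → d) ]′
        (p∣*⇒ (∑< p w) (F a) (≈0⇒∣ (≈-trans (≈-sym (corr≈ a)) (≈-reflexive (corr≡0 a)))))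

  p^∣Δ : ∀ w → ¬ + p ∣ ∑< p w → ∀ k h → Periodic h → Constant (corr w h) → ∀ a → + (p ℕ.^ k) ∣ Δ h a
  p^∣Δ w ndiv zero    h per const a = divides (Δ h a) (sym (ℤₚ.*-identityʳ (Δ h a)))
  p^∣Δ w ndiv (suc k) h per const a = lift (p^∣Δ w ndiv k h₁ h₁-per h₁-const a)
    where
    h≈ : ∀ a → + p ∣ h a - h 0
    h≈ a = ≈⇒∣ (Δ≈0⇒≈ h (constant-mod-p w h ndiv per const) a 0)
    h₁ : ℕ → ℤ
    h₁ a = _∣_.quotient (h≈ a)
    h₁-eq : ∀ a → h a ≡ h₁ a * + p + h 0
    h₁-eq a = trans (lem (h a) (h 0)) (cong (_+ h 0) (_∣_.equality (h≈ a)))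
      where
      lem : ∀ x y → x ≡ x - y + y
      lem = solve-∀
    Δh : ∀ a → Δ h a ≡ Δ h₁ a * + p
    Δh a = trans (cong₂ _-_ (h₁-eq (suc a)) (h₁-eq a)) (lem (h₁ (suc a)) (h₁ a) (+ p) (h 0))
      where
      lem : ∀ x y p z → (x * p + z) - (y * p + z) ≡ (x - y) * p
      lem = solve-∀
    h₁-per : Periodic h₁
    h₁-per a = ℤₚ.*-cancelʳ-≡ (h₁ (a ℕ.+ p)) (h₁ a) (+ p)
      (trans (sym (_∣_.equality (h≈ (a ℕ.+ p)))) (trans (cong (_- h 0) (per a)) (_∣_.equality (h≈ a))))
    h₁-const : Constant (corr w h₁)
    h₁-const c = p*x≡0⇒x≡0 (Δ (corr w h₁) c) (begin
      + p * Δ (corr w h₁) c                      ≡⟨ cong (+ p *_) (corr-Δ w h₁ c) ⟨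
      + p * corr w (Δ h₁) c                      ≡⟨ ∑-*ˡ (downFrom p) (+ p) (λ a → w a * Δ h₁ (c ℕ.+ a)) ⟨
      ∑< p (λ a → + p * (w a * Δ h₁ (c ℕ.+ a)))  ≡⟨ ∑-cong (downFrom p)
        (λ a → trans (lem (+ p) (w a) (Δ h₁ (c ℕ.+ a))) (cong (w a *_) (sym (Δh (c ℕ.+ a))))) ⟩
      corr w (Δ h) c                             ≡⟨ corr-Δ w h c ⟩
      Δ (corr w h) c                             ≡⟨ const c ⟩
      0ℤ                                         ∎)
      where
      open ≡-Reasoning
      lem : ∀ p a b → p * (a * b) ≡ a * (b * p)
      lem = solve-∀
    lift : + (p ℕ.^ k) ∣ Δ h₁ a → + (p ℕ.^ suc k) ∣ Δ h a
    lift (divides m e) = divides m (begin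
      Δ h a                       ≡⟨ Δh a ⟩
      Δ h₁ a * + p                ≡⟨ cong (_* + p) e ⟩
      m * + (p ℕ.^ k) * + p       ≡⟨ lem m (+ (p ℕ.^ k)) (+ p) ⟩
      m * (+ p * + (p ℕ.^ k))     ≡⟨ cong (m *_) (ℤₚ.pos-* p (p ℕ.^ k)) ⟨
      m * + (p ℕ.^ suc k)         ∎)
      where
      open ≡-Reasoning
      lem : ∀ x y z → x * y * z ≡ x * (z * y)
      lem = solve-∀

  k<p^k : ∀ k → k ℕ.< p ℕ.^ k
  k<p^k zero    = ℕ.s≤s ℕ.z≤n
  k<p^k (suc k) = ℕₚ.≤-<-trans (k<p^k k) (ℕₚ.^-monoʳ-< p (ℕ.nonTrivial⇒n>1 p {{prime⇒nonTrivial p-prime}}) (ℕₚ.n<1+n k))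

  p^∣⇒≡0 : ∀ x → (∀ k → + (p ℕ.^ k) ∣ x) → x ≡ 0ℤ
  p^∣⇒≡0 x d = ℤₚ.∣i∣≡0⇒i≡0 (go ∣ x ∣ (∣⇒∣ᵤ (d ∣ x ∣)))
    where
    go : ∀ a → p ℕ.^ a ℕ∣.∣ a → a ≡ 0
    go zero    _  = refl
    go (suc a) d′ = contradiction (ℕ∣.∣⇒≤ d′) (ℕₚ.<⇒≱ (k<p^k (suc a)))

  corr-constant : ∀ w h → ¬ + p ∣ ∑< p w → Periodic h → Constant (corr w h) → Constant h
  corr-constant w h ndiv per const a = p^∣⇒≡0 (Δ h a) λ k → p^∣Δ w ndiv k h per const a

  record Δ-Quotient (w : ℕ → ℤ) : Set where
    field
      w₁     : ℕ → ℤ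
      s      : ℤ
      w₁-per : Periodic w₁
      w-eq   : ∀ a → w a ≡ s + Δ w₁ a

  divide-by-Δ : ∀ w → Periodic w → + p ∣ ∑< p w → Δ-Quotient w
  divide-by-Δ w per (divides s eq) = record { w₁ = w₁ ; s = s ; w₁-per = w₁-per ; w-eq = λ a → lem (w a) s (w₁ a) }
    where
    w₁ : ℕ → ℤ
    w₁ a = ∑< a λ i → w i - s
    w₁-per : Periodic w₁
    w₁-per zero = begin
      ∑< p (λ i → w i - s)             ≡⟨ ∑-- (downFrom p) w (λ _ → s) ⟩
      ∑< p w - ∑< p (λ _ → s)          ≡⟨ cong₂ _-_ eq
        (trans (∑-const (downFrom p) s) (cong (λ l → + l * s) (length-downFrom p))) ⟩
      s * + p - + p * s                ≡⟨ lem₀ s (+ p) ⟩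
      0ℤ                               ∎
      where
      open ≡-Reasoning
      lem₀ : ∀ s p → s * p - p * s ≡ 0ℤ
      lem₀ = solve-∀
    w₁-per (suc a) = cong₂ _+_ (cong (_- s) (per a)) (w₁-per a)
    lem : ∀ x s y → x ≡ s + ((x - s + y) - y)
    lem = solve-∀

  corr-Δ-Quotient : ∀ w h (Q : Δ-Quotient w) → Periodic h → Constant (corr w h) → Constant (corr (Δ-Quotient.w₁ Q) h)
  corr-Δ-Quotient w h Q per const c = trans (Δu≡K c) K≡0
    where
    open Δ-Quotient Q
    u = corr w₁ h
    K = s * ∑< p h - corr w h 0
    shifted : ∀ c → corr w h (suc c) ≡ s * ∑< p h + (u c - u (suc c))
    shifted c = begin
      ∑< p (λ a → w a * h (suc c ℕ.+ a))
        ≡⟨ ∑-cong (downFrom p) (λ a → trans (cong (_* h (suc c ℕ.+ a)) (w-eq a))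
          (lem s (w₁ (suc a)) (w₁ a) (h (suc c ℕ.+ a)))) ⟩
      ∑< p (λ a → s * h (suc c ℕ.+ a) + (w₁ (suc a) * h (suc c ℕ.+ a) - w₁ a * h (suc c ℕ.+ a)))
        ≡⟨ trans (∑-+ (downFrom p) (λ a → s * h (suc c ℕ.+ a)) (λ a → w₁ (suc a) * h (suc c ℕ.+ a) - w₁ a * h (suc c ℕ.+ a)))
             (cong₂ _+_ (∑-*ˡ (downFrom p) s (λ a → h (suc c ℕ.+ a)))
               (∑-- (downFrom p) (λ a → w₁ (suc a) * h (suc c ℕ.+ a)) (λ a → w₁ a * h (suc c ℕ.+ a)))) ⟩
      s * ∑< p (λ a → h (suc c ℕ.+ a)) + (∑< p (λ a → w₁ (suc a) * h (suc c ℕ.+ a)) - u (suc c))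
        ≡⟨ cong₂ (λ x y → s * x + (y - u (suc c))) (∑<-shift-+ h per (suc c))
             (trans (∑-cong (downFrom p) λ a → cong (λ b → w₁ (suc a) * h b) (sym (ℕₚ.+-suc c a)))
               (∑<-shift (λ a → w₁ a * h (c ℕ.+ a)) prod-per)) ⟩
      s * ∑< p h + (u c - u (suc c)) ∎
      where
      open ≡-Reasoning
      lem : ∀ s x y z → (s + (x - y)) * z ≡ s * z + (x * z - y * z)
      lem = solve-∀
      prod-per : Periodic (λ a → w₁ a * h (c ℕ.+ a))
      prod-per a = cong₂ _*_ (w₁-per a) (trans (cong h (sym (ℕₚ.+-assoc c a p))) (per (c ℕ.+ a)))
    Δu≡K : ∀ c → Δ u c ≡ K
    Δu≡K c = trans (lem (u (suc c)) (u c) (s * ∑< p h)) (cong (_-_ (s * ∑< p h)) (trans (sym (shifted c)) corr-const))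
      where
      lem : ∀ x y z → x - y ≡ z - (z + (y - x))
      lem = solve-∀
      corr-const : corr w h (suc c) ≡ corr w h 0
      corr-const = trans (Δ-const⇒linear {corr w h} {0ℤ} const (suc c))
        (trans (cong (_+_ (corr w h 0)) (ℤₚ.*-zeroʳ (+ suc c))) (ℤₚ.+-identityʳ (corr w h 0)))
    K≡0 : K ≡ 0ℤ
    K≡0 = p*x≡0⇒x≡0 K (∙-cancelˡ (u 0) (+ p * K) 0ℤ
      (trans (sym (Δ-const⇒linear {u} {K} Δu≡K p)) (trans (corr-periodic w₁ h per 0) (sym (ℤₚ.+-identityʳ (u 0))))))

  -- This stands in for the irreducibility of 1 + x + ⋯ + xᵖ⁻¹: if h is not constant then w, up to constants,
  -- can be divided by Δ indefinitely, while Δᵖ vanishes modulo p.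
  corr-constant⇒≈ : ∀ w h → Periodic w → Periodic h → Constant (corr w h) → ¬ Constant h → ∀ a → Δ w a ≈ 0ℤ
  corr-constant⇒≈ w h w-per h-per const nonconst a = finish (iter (ℕ.pred p))
    where
    Root : ℕ → Set
    Root j = Σ (ℕ → ℤ) λ v → Periodic v × Constant (corr v h) × (∀ x → Δ^ (suc j) v x ≡ Δ w x)
    iter : ∀ j → Root j
    iter zero = w , w-per , const , λ _ → refl
    iter (suc j) = step (iter j)
      where
      step : Root j → Root (suc j)
      step (v , v-per , v-const , v-eq) with + p ∣? ∑< p v
      ... | no ndiv = contradiction (corr-constant v h ndiv h-per v-const) nonconst
      ... | yes d   = w₁ , w₁-per , corr-Δ-Quotient v h Q h-per v-const , λ x → trans (Δ^-cong j Δ-eq x) (v-eq x)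
        where
        Q = divide-by-Δ v v-per d
        open Δ-Quotient Q
        Δ-eq : ∀ b → Δ (Δ w₁) b ≡ Δ v b
        Δ-eq b = sym (trans (cong₂ _-_ (w-eq (suc b)) (w-eq b)) (lem s (Δ w₁ (suc b)) (Δ w₁ b)))
          where
          lem : ∀ s x y → (s + x) - (s + y) ≡ x - y
          lem = solve-∀
    finish : Root (ℕ.pred p) → Δ w a ≈ 0ℤ
    finish (v , v-per , _ , v-eq) = ≈-trans (≈-reflexive (sym (v-eq a)))
      (subst (λ m → Δ^ m v a ≈ 0ℤ) (sym (ℕₚ.suc-pred p)) (Δ^p≈0 v v-per a))

  small-≈⇒≡ : ∀ {a b} → a ℕ.< p → b ℕ.< p → + a ≈ + b → a ≡ b
  small-≈⇒≡ {a} {b} a<p b<p e = ℤₚ.+-injective (ℤₚ.i-j≡0⇒i≡j (+ a) (+ b) (∣x∣<p⇒≡0 {+ a - + b} small (≈⇒∣ e)))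
    where
    small : ∣ + a - + b ∣ ℕ.< p
    small = ℕₚ.≤-<-trans (subst (λ z → ∣ z ∣ ℕ.≤ a ℕ.⊔ b) (sym (ℤₚ.m-n≡m⊖n a b)) (ℤₚ.∣m⊝n∣≤m⊔n a b)) (ℕₚ.⊔-pres-<m a<p b<p)

  %ℕ-≈ : ∀ z → + (z %ℕ p) ≈ z
  %ℕ-≈ z = mod-p (divides (- (z /ℕ p))
    (trans (cong (_-_ (+ (z %ℕ p))) (a≡a%ℕn+[a/ℕn]*n z p)) (lem (+ (z %ℕ p)) (z /ℕ p) (+ p))))
    where
    lem : ∀ r k m → r - (r + k * m) ≡ - k * m
    lem = solve-∀

  toℤ : Fin p → ℤ
  toℤ a = + toℕ a

  red : ℤ → Fin p
  red z = fromℕ< (n%ℕd<d z p)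

  toℤ-red : ∀ z → toℤ (red z) ≈ z
  toℤ-red z = ≈-trans (≈-reflexive (cong +_ (Finₚ.toℕ-fromℕ< (n%ℕd<d z p)))) (%ℕ-≈ z)

  toℤ-injective : ∀ {a b} → toℤ a ≈ toℤ b → a ≡ b
  toℤ-injective {a} {b} e = Finₚ.toℕ-injective (small-≈⇒≡ (Finₚ.toℕ<n a) (Finₚ.toℕ<n b) e)

  red-cong : ∀ {x y} → x ≈ y → red x ≡ red y
  red-cong {x} {y} e = toℤ-injective (≈-trans (toℤ-red x) (≈-trans e (≈-sym (toℤ-red y))))

  red-toℤ : ∀ a → red (toℤ a) ≡ a
  red-toℤ a = toℤ-injective (toℤ-red (toℤ a))

  inverse : ∀ z → ¬ + p ∣ z → Σ ℤ λ e → e * z ≈ 1ℤ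
  inverse z ndiv = go (z %ℕ p) (n%ℕd<d z p) (%ℕ-≈ z)
    where
    go : ∀ r → r ℕ.< p → + r ≈ z → Σ ℤ λ e → e * z ≈ 1ℤ
    go zero    r<p r≈z = contradiction (≈0⇒∣ (≈-sym r≈z)) ndiv
    go (suc r) r<p r≈z = bez (coprime-Bézout (prime⇒coprime p-prime r<p))
      where
      bez : Bézout.Identity 1 p (suc r) → Σ ℤ λ e → e * z ≈ 1ℤ
      bez (Bézout.+- x y eq) = - + y , ≈-trans (*-congˡ-≈ (- + y) (≈-sym r≈z)) (mod-p (divides (- + x) (begin
        - + y * + suc r - 1ℤ        ≡⟨ lem (+ y) (+ suc r) ⟩
        - (1ℤ + + y * + suc r)      ≡⟨ cong (λ t → - (1ℤ + t)) (ℤₚ.pos-* y (suc r)) ⟨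
        - + (1 ℕ.+ y ℕ.* suc r)     ≡⟨ cong (λ t → - + t) eq ⟩
        - + (x ℕ.* p)               ≡⟨ cong -_ (ℤₚ.pos-* x p) ⟩
        - (+ x * + p)               ≡⟨ lem′ (+ x) (+ p) ⟩
        - + x * + p                 ∎)))
        where
        open ≡-Reasoning
        lem : ∀ y s → - y * s - 1ℤ ≡ - (1ℤ + y * s)
        lem = solve-∀
        lem′ : ∀ x p → - (x * p) ≡ - x * p
        lem′ = solve-∀
      bez (Bézout.-+ x y eq) = + y , ≈-trans (*-congˡ-≈ (+ y) (≈-sym r≈z)) (mod-p (divides (+ x) (begin
        + y * + suc r - 1ℤ          ≡⟨ cong (_- 1ℤ) (ℤₚ.pos-* y (suc r)) ⟨
        + (y ℕ.* suc r) - 1ℤ        ≡⟨ cong (λ t → + t - 1ℤ) eq ⟨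
        1ℤ + + (x ℕ.* p) - 1ℤ       ≡⟨ cong (λ t → 1ℤ + t - 1ℤ) (ℤₚ.pos-* x p) ⟩
        1ℤ + + x * + p - 1ℤ         ≡⟨ lem (+ x) (+ p) ⟩
        + x * + p                   ∎)))
        where
        open ≡-Reasoning
        lem : ∀ x p → 1ℤ + x * p - 1ℤ ≡ x * p
        lem = solve-∀

  χ : ℤ → ℤ
  χ z with + p ∣? z
  ... | yes _ = 1ℤ
  ... | no  _ = 0ℤ

  χ≡1 : ∀ {z} → + p ∣ z → χ z ≡ 1ℤ
  χ≡1 {z} d with + p ∣? z
  ... | yes _ = refl
  ... | no nd = contradiction d nd

  χ≡0 : ∀ {z} → ¬ + p ∣ z → χ z ≡ 0ℤ
  χ≡0 {z} nd with + p ∣? z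
  ... | yes d = contradiction d nd
  ... | no _  = refl

  χ-cong : ∀ {x y} → x ≈ y → χ x ≡ χ y
  χ-cong {x} {y} e with + p ∣? y
  ... | yes d = χ≡1 (≈0⇒∣ (≈-trans e (∣⇒≈0 d)))
  ... | no nd = χ≡0 λ d → nd (≈0⇒∣ (≈-trans (≈-sym e) (∣⇒≈0 d)))

  0≤χ : ∀ z → 0ℤ ≤ χ z
  0≤χ z with + p ∣? z
  ... | yes _ = +≤+ ℕ.z≤n
  ... | no  _ = +≤+ ℕ.z≤n

  χ≤1 : ∀ z → χ z ≤ 1ℤ
  χ≤1 z with + p ∣? z
  ... | yes _ = +≤+ (ℕ.s≤s ℕ.z≤n)
  ... | no  _ = +≤+ ℕ.z≤n

  ∑<-χ : ∀ (F : ℤ → ℤ) → (∀ {x y} → x ≈ y → F x ≡ F y) → ∀ z → ∑< p (λ a → χ (z - + a) * F (+ a)) ≡ F z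
  ∑<-χ F F-cong z = trans (∑<-single p (λ a → χ (z - + a) * F (+ a)) r (n%ℕd<d z p) others)
    (trans (cong₂ _*_ (χ≡1 (≈⇒∣ (≈-sym (%ℕ-≈ z)))) (F-cong (%ℕ-≈ z))) (ℤₚ.*-identityˡ (F z)))
    where
    r = z %ℕ p
    others : ∀ b → b ℕ.< p → b ≢ r → χ (z - + b) * F (+ b) ≡ 0ℤ
    others b b<p b≢r = trans (cong (_* F (+ b))
      (χ≡0 λ d → b≢r (small-≈⇒≡ b<p (n%ℕd<d z p) (≈-trans (≈-sym (mod-p d)) (≈-sym (%ℕ-≈ z)))))) (ℤₚ.*-zeroˡ (F (+ b)))

  -- Sums over the vertices of the grid

  Vtx : ℕ → Set
  Vtx = Vertex p

  allV : ∀ d → List (Vtx d)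
  allV zero    = [] ∷ []
  allV (suc d) = concatMap (λ a → map (red (+ a) ∷_) (allV d)) (downFrom p)

  ∈-allV : ∀ {d} (v : Vtx d) → v ∈ allV d
  ∈-allV []      = here refl
  ∈-allV {suc d} (a ∷ v) = ∈-concatMap⁺ (λ b → map (red (+ b) ∷_) (allV d)) (Any.map cons (∈-downFrom⁺ (Finₚ.toℕ<n a)))
    where
    cons : ∀ {b} → toℕ a ≡ b → (a ∷ v) ∈ map (red (+ b) ∷_) (allV d)
    cons refl = subst (λ c → (c ∷ v) ∈ map (red (toℤ a) ∷_) (allV d)) (red-toℤ a) (∈-map⁺ (red (toℤ a) ∷_) (∈-allV v))

  ∑V : ∀ {d} → (Vtx d → ℤ) → ℤ
  ∑V {d} = ∑ (allV d)

  ∑V-suc : ∀ {d} (F : Vtx (suc d) → ℤ) → ∑V F ≡ ∑< p (λ a → ∑V (λ v → F (red (+ a) ∷ v)))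
  ∑V-suc {d} F = trans (∑-concatMap (λ a → map (red (+ a) ∷_) (allV d)) (downFrom p) F)
    (∑-cong (downFrom p) λ a → ∑-map (red (+ a) ∷_) (allV d) F)

  ∑V-single : ∀ {d} (F : Vtx d → ℤ) (u : Vtx d) → (∀ v → v ≢ u → F v ≡ 0ℤ) → ∑V F ≡ F u
  ∑V-single F [] e = ℤₚ.+-identityʳ (F [])
  ∑V-single {suc d} F (b ∷ u) e = begin
    ∑V F                                 ≡⟨ ∑V-suc F ⟩
    ∑< p G                               ≡⟨ ∑<-single p G (toℕ b) (Finₚ.toℕ<n b) others ⟩
    ∑V (λ v → F (red (toℤ b) ∷ v))       ≡⟨ ∑-cong (allV d) (λ v → cong (λ c → F (c ∷ v)) (red-toℤ b)) ⟩
    ∑V (λ v → F (b ∷ v))                 ≡⟨ ∑V-single (λ v → F (b ∷ v)) u (λ v v≢u → e (b ∷ v) (v≢u ∘ Vecₚ.∷-injectiveʳ)) ⟩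
    F (b ∷ u)                            ∎
    where
    open ≡-Reasoning
    G : ℕ → ℤ
    G a = ∑V (λ v → F (red (+ a) ∷ v))
    others : ∀ a → a ℕ.< p → a ≢ toℕ b → G a ≡ 0ℤ
    others a a<p a≢b = ∑-zero (allV d) λ v → e (red (+ a) ∷ v) λ eq →
      a≢b (small-≈⇒≡ a<p (Finₚ.toℕ<n b) (≈-trans (≈-sym (toℤ-red (+ a))) (≈-reflexive (cong toℤ (Vecₚ.∷-injectiveˡ eq)))))

  lookup-injective : ∀ {d} (v w : Vtx d) → (∀ i → lookup v i ≡ lookup w i) → v ≡ w
  lookup-injective v w e = trans (sym (Vecₚ.tabulate∘lookup v)) (trans (Vecₚ.tabulate-cong e) (Vecₚ.tabulate∘lookup w))

  shift : ∀ {d} → ℤ → Fin d → Vtx d → Vtx d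
  shift k i v = updateAt v i (λ a → red (toℤ a + k))

  ∑<-translate : ∀ (F : Fin p → ℤ) k → ∑< p (λ a → F (red (+ a + k))) ≡ ∑< p (λ a → F (red (+ a)))
  ∑<-translate F k = trans (∑-cong (downFrom p) λ a → cong F
    (red-cong (≈-trans (+-cong-≈ (≈-refl {x = + a}) (≈-sym (%ℕ-≈ k))) (≈-reflexive (ℤₚ.+-comm (+ a) (+ (k %ℕ p)))))))
    (∑<-shift-+ (λ a → F (red (+ a))) per (k %ℕ p))
    where
    per : Periodic (λ a → F (red (+ a)))
    per a = cong F (red-cong {+ (a ℕ.+ p)} {+ a} (mod-p (divides 1ℤ (lem (+ a) (+ p)))))
      where
      lem : ∀ a p → (a + p) - a ≡ 1ℤ * p
      lem = solve-∀

  ∑V-shift : ∀ {d} k (i : Fin d) (F : Vtx d → ℤ) → ∑V (λ v → F (shift k i v)) ≡ ∑V F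
  ∑V-shift {suc d} k Fin.zero F = begin
    ∑V (λ v → F (shift k Fin.zero v))                                      ≡⟨ ∑V-suc (λ v → F (shift k Fin.zero v)) ⟩
    ∑< p (λ a → G (red (toℤ (red (+ a)) + k)))                             ≡⟨ ∑-cong (downFrom p)
      (λ a → cong G (red-cong (+-cong-≈ (toℤ-red (+ a)) (≈-refl {x = k})))) ⟩
    ∑< p (λ a → G (red (+ a + k)))                                         ≡⟨ ∑<-translate G k ⟩
    ∑< p (λ a → G (red (+ a)))                                             ≡⟨ ∑V-suc F ⟨
    ∑V F                                                                   ∎
    where
    open ≡-Reasoning
    G : Fin p → ℤ
    G b = ∑V (λ v → F (b ∷ v))
  ∑V-shift {suc d} k (Fin.suc i) F = trans (∑V-suc (λ v → F (shift k (Fin.suc i) v)))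
    (trans (∑-cong (downFrom p) λ a → ∑V-shift k i (λ v → F (red (+ a) ∷ v))) (sym (∑V-suc F)))

  dot : ∀ {d} → Vtx d → Vec ℤ d → ℤ
  dot []      []      = 0ℤ
  dot (a ∷ v) (x ∷ u) = toℤ a * x + dot v u

  coords : ∀ {d} → Vtx d → Vec ℤ d
  coords = Vec.map toℤ

  dot-comm : ∀ {d} (v w : Vtx d) → dot v (coords w) ≡ dot w (coords v)
  dot-comm []      []      = refl
  dot-comm (a ∷ v) (b ∷ w) = cong₂ _+_ (ℤₚ.*-comm (toℤ a) (toℤ b)) (dot-comm v w)

  dot-- : ∀ {d} (v : Vtx d) (x y : Vec ℤ d) → dot v (zipWith _-_ x y) ≡ dot v x - dot v y
  dot-- []      []      []      = refl
  dot-- (a ∷ v) (x ∷ u) (y ∷ w) = trans (cong (_+_ (toℤ a * (x - y))) (dot-- v u w)) (lem (toℤ a) x y (dot v u) (dot v w))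
    where
    lem : ∀ a x y s t → a * (x - y) + (s - t) ≡ (a * x + s) - (a * y + t)
    lem = solve-∀

  dot-shift : ∀ {d} k i (v : Vtx d) (u : Vec ℤ d) → dot (shift k i v) u ≈ dot v u + k * lookup u i
  dot-shift k Fin.zero (a ∷ v) (x ∷ u) = ≈-trans (+-cong-≈ (*-congʳ-≈ x (toℤ-red (toℤ a + k))) (≈-refl {x = dot v u}))
    (≈-reflexive (lem (toℤ a) k x (dot v u)))
    where
    lem : ∀ a k x s → (a + k) * x + s ≡ a * x + s + k * x
    lem = solve-∀
  dot-shift k (Fin.suc i) (a ∷ v) (x ∷ u) = ≈-trans (+-cong-≈ (≈-refl {x = toℤ a * x}) (dot-shift k i v u))
    (≈-reflexive (sym (ℤₚ.+-assoc (toℤ a * x) (dot v u) (k * lookup u i))))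

  scale : ∀ {d} → ℤ → Vtx d → Vtx d
  scale e = Vec.map (λ a → red (e * toℤ a))

  dot-scale : ∀ {d} e (v ξ : Vtx d) → dot v (coords (scale e ξ)) ≈ e * dot v (coords ξ)
  dot-scale e []      []      = ≈-reflexive (sym (ℤₚ.*-zeroʳ e))
  dot-scale e (a ∷ v) (b ∷ ξ) = ≈-trans (+-cong-≈ (*-congˡ-≈ (toℤ a) (toℤ-red (e * toℤ b))) (dot-scale e v ξ))
    (≈-reflexive (lem e (toℤ a) (toℤ b) (dot v (coords ξ))))
    where
    lem : ∀ e a b s → a * (e * b) + e * s ≡ e * (a * b + s)
    lem = solve-∀

  #V : ℕ → ℤ
  #V d = ∑V {d} λ _ → 1ℤ

  #V≢0 : ∀ d → #V d ≢ 0ℤ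
  #V≢0 d e with ∑≤0⇒≡0 (allV d) {λ _ → 1ℤ} (λ _ → +≤+ ℕ.z≤n) (ℤₚ.≤-reflexive e) (∈-allV (Vec.replicate d (red 0ℤ)))
  ... | ()

  hyperplane-size : ∀ {d} (u : Vec ℤ d) i → ¬ + p ∣ lookup u i → + p * ∑V (λ v → χ (dot v u)) ≡ #V d
  hyperplane-size {d} u i ndiv = begin
    + p * N₀                                        ≡⟨ cong (λ l → + l * N₀) (length-downFrom p) ⟨
    + length (downFrom p) * N₀                      ≡⟨ ∑-const (downFrom p) N₀ ⟨
    ∑< p (λ _ → N₀)                                 ≡⟨ ∑-cong (downFrom p) (λ a → parallel (+ a)) ⟩
    ∑< p (λ a → ∑V (λ v → χ (dot v u - + a)))       ≡⟨ ∑-swap (downFrom p) (allV d) (λ a v → χ (dot v u - + a)) ⟩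
    ∑V (λ v → ∑< p (λ a → χ (dot v u - + a)))       ≡⟨ ∑-cong (allV d)
      (λ v → trans (∑-cong (downFrom p) λ a → sym (ℤₚ.*-identityʳ (χ (dot v u - + a))))
      (∑<-χ (λ _ → 1ℤ) (λ _ → refl) (dot v u))) ⟩
    #V d                                            ∎
    where
    open ≡-Reasoning
    N₀ = ∑V (λ v → χ (dot v u))
    e = proj₁ (inverse (lookup u i) ndiv)
    parallel : ∀ c → N₀ ≡ ∑V (λ v → χ (dot v u - c))
    parallel c = trans (∑-cong (allV d) λ v → χ-cong (≈-sym (moved v))) (∑V-shift (c * e) i (λ v → χ (dot v u - c)))
      where
      lem : ∀ s c e x → (s + c * e * x) - c ≡ s + c * (e * x) - c * 1ℤ
      lem = solve-∀
      lem′ : ∀ s c → s + c * 1ℤ - c * 1ℤ ≡ s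
      lem′ = solve-∀
      moved : ∀ v → dot (shift (c * e) i v) u - c ≈ dot v u
      moved v = ≈-trans (+-cong-≈ (dot-shift (c * e) i v u) (≈-refl {x = - c}))
        (≈-trans (≈-reflexive (lem (dot v u) c e (lookup u i)))
        (≈-trans (+-cong-≈ (+-cong-≈ (≈-refl {x = dot v u}) (*-congˡ-≈ c (proj₂ (inverse (lookup u i) ndiv))))
          (≈-refl {x = - (c * 1ℤ)}))
                 (≈-reflexive (lem′ (dot v u) c))))

  cover : ∀ {d} → (Vtx d → ℤ) → Vtx d → ℤ
  cover {d} f v = f v + ∑ (allFin d) (λ i → f (shift 1ℤ i v) + f (shift (- 1ℤ) i v))

  ∑V-cover : ∀ {d} (f : Vtx d → ℤ) → ∑V (cover f) ≡ (1ℤ + + d * + 2) * ∑V f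
  ∑V-cover {d} f = begin
    ∑V (cover f)
      ≡⟨ ∑-+ (allV d) f (λ v → ∑ (allFin d) (λ i → f (shift 1ℤ i v) + f (shift (- 1ℤ) i v))) ⟩
    ∑V f + ∑V (λ v → ∑ (allFin d) (λ i → f (shift 1ℤ i v) + f (shift (- 1ℤ) i v)))
      ≡⟨ cong (_+_ (∑V f)) (∑-swap (allV d) (allFin d) (λ v i → f (shift 1ℤ i v) + f (shift (- 1ℤ) i v))) ⟩
    ∑V f + ∑ (allFin d) (λ i → ∑V (λ v → f (shift 1ℤ i v) + f (shift (- 1ℤ) i v)))
      ≡⟨ cong (_+_ (∑V f)) (∑-cong (allFin d) λ i → trans
        (∑-+ (allV d) (λ v → f (shift 1ℤ i v)) (λ v → f (shift (- 1ℤ) i v)))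
           (cong₂ _+_ (∑V-shift 1ℤ i f) (∑V-shift (- 1ℤ) i f))) ⟩
    ∑V f + ∑ (allFin d) (λ _ → ∑V f + ∑V f)
      ≡⟨ cong (_+_ (∑V f)) (trans (∑-const (allFin d) (∑V f + ∑V f))
        (cong (λ l → + l * (∑V f + ∑V f)) (length-tabulate {n = d} (λ i → i)))) ⟩
    ∑V f + + d * (∑V f + ∑V f)
      ≡⟨ lem (∑V f) (+ d) ⟩
    (1ℤ + + d * + 2) * ∑V f ∎
    where
    open ≡-Reasoning
    lem : ∀ s d → s + d * (s + s) ≡ (1ℤ + d * + 2) * s
    lem = solve-∀

  -- The Radon transform

  radon : ∀ {d} → (Vtx d → ℤ) → Vtx d → ℤ → ℤ
  radon g ξ c = ∑V λ v → χ (dot v (coords ξ) - c) * g v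

  radon-cong : ∀ {d} (g : Vtx d → ℤ) ξ {c e} → c ≈ e → radon g ξ c ≡ radon g ξ e
  radon-cong {d} g ξ e = ∑-cong (allV d) λ v → cong (_* g v)
    (χ-cong (+-cong-≈ (≈-refl {x = dot v (coords ξ)}) (neg-cong-≈ e)))

  radon-translate : ∀ {d} (g : Vtx d → ℤ) ξ c k i →
    radon g ξ (c + k * toℤ (lookup ξ i)) ≡ ∑V (λ v → χ (dot v (coords ξ) - c) * g (shift k i v))
  radon-translate {d} g ξ c k i = trans (sym (∑V-shift k i (λ v → χ (dot v (coords ξ) - c′) * g v)))
    (∑-cong (allV d) λ v → cong (_* g (shift k i v)) (χ-cong (moved v)))
    where
    x = toℤ (lookup ξ i)
    c′ = c + k * x
    lem : ∀ s k x c → (s + k * x) - (c + k * x) ≡ s - c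
    lem = solve-∀
    moved : ∀ v → dot (shift k i v) (coords ξ) - c′ ≈ dot v (coords ξ) - c
    moved v = ≈-trans (+-cong-≈ (≈-trans (dot-shift k i v (coords ξ))
      (≈-reflexive (cong (λ t → dot v (coords ξ) + k * t) (Vecₚ.lookup-map i toℤ ξ)))) (≈-refl {x = - c′}))
                      (≈-reflexive (lem (dot v (coords ξ)) k x c))

  radon-cover : ∀ {d} (g : Vtx d → ℤ) → (∀ v → cover g v ≡ 0ℤ) → ∀ ξ c →
    radon g ξ c + ∑ (allFin d) (λ i → radon g ξ (c + toℤ (lookup ξ i)) + radon g ξ (c - toℤ (lookup ξ i))) ≡ 0ℤ
  radon-cover {d} g g-cover ξ c = begin
    radon g ξ c + ∑ (allFin d) (λ i → radon g ξ (c + x i) + radon g ξ (c - x i))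
      ≡⟨ cong (_+_ (radon g ξ c)) (∑-cong (allFin d) λ i → trans (cong₂ _+_
           (trans (cong (λ t → radon g ξ (c + t)) (sym (ℤₚ.*-identityˡ (x i)))) (radon-translate g ξ c 1ℤ i))
           (trans (cong (λ t → radon g ξ (c + t)) (sym (ℤₚ.-1*i≡-i (x i)))) (radon-translate g ξ c (- 1ℤ) i)))
           (sym (∑-+ (allV d) (λ v → X v * g (shift 1ℤ i v)) (λ v → X v * g (shift (- 1ℤ) i v))))) ⟩
    radon g ξ c + ∑ (allFin d) (λ i → ∑V (λ v → X v * g (shift 1ℤ i v) + X v * g (shift (- 1ℤ) i v)))
      ≡⟨ cong (_+_ (radon g ξ c)) (∑-swap (allFin d) (allV d)
        (λ i v → X v * g (shift 1ℤ i v) + X v * g (shift (- 1ℤ) i v))) ⟩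
    radon g ξ c + ∑V (λ v → ∑ (allFin d) (λ i → X v * g (shift 1ℤ i v) + X v * g (shift (- 1ℤ) i v)))
      ≡⟨ ∑-+ (allV d) (λ v → X v * g v) (λ v → ∑ (allFin d) (λ i → X v * g (shift 1ℤ i v) + X v * g (shift (- 1ℤ) i v))) ⟨
    ∑V (λ v → X v * g v + ∑ (allFin d) (λ i → X v * g (shift 1ℤ i v) + X v * g (shift (- 1ℤ) i v)))
      ≡⟨ ∑-cong (allV d) (λ v → trans
        (cong (_+_ (X v * g v)) (trans
        (∑-cong (allFin d) λ i → sym (ℤₚ.*-distribˡ-+ (X v) (g (shift 1ℤ i v)) (g (shift (- 1ℤ) i v))))
           (∑-*ˡ (allFin d) (X v) (λ i → g (shift 1ℤ i v) + g (shift (- 1ℤ) i v)))))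
             (sym (ℤₚ.*-distribˡ-+ (X v) (g v) (∑ (allFin d) (λ i → g (shift 1ℤ i v) + g (shift (- 1ℤ) i v)))))) ⟩
    ∑V (λ v → X v * cover g v)
      ≡⟨ ∑-zero (allV d) (λ v → trans (cong (X v *_) (g-cover v)) (ℤₚ.*-zeroʳ (X v))) ⟩
    0ℤ ∎
    where
    open ≡-Reasoning
    x : Fin d → ℤ
    x i = toℤ (lookup ξ i)
    X : Vtx d → ℤ
    X v = χ (dot v (coords ξ) - c)

  radon-total : ∀ {d} (g : Vtx d → ℤ) ξ → ∑< p (λ a → radon g ξ (+ a)) ≡ ∑V g
  radon-total {d} g ξ = trans (∑-swap (downFrom p) (allV d) (λ a v → χ (dot v (coords ξ) - + a) * g v))
    (∑-cong (allV d) λ v → ∑<-χ (λ _ → g v) (λ _ → refl) (dot v (coords ξ)))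

  radon-inversion : ∀ {d} (g : Vtx d → ℤ) → ∑V g ≡ 0ℤ → ∀ v →
    + p * ∑V (λ ξ → radon g ξ (dot v (coords ξ))) ≡ (+ p - 1ℤ) * #V d * g v
  radon-inversion {d} g ∑g≡0 v = begin
    + p * ∑V (λ ξ → ∑V (λ w → χ (dot w (coords ξ) - dot v (coords ξ)) * g w))
      ≡⟨ cong (+ p *_) (trans (∑-swap (allV d) (allV d) (λ ξ w → χ (dot w (coords ξ) - dot v (coords ξ)) * g w))
           (∑-cong (allV d) λ w → trans (∑-*ʳ (allV d) (g w) (λ ξ → χ (dot w (coords ξ) - dot v (coords ξ))))
             (cong (_* g w) (∑-cong (allV d) λ ξ → cong χ (bilinear ξ w))))) ⟩
    + p * ∑V (λ w → N w * g w)
      ≡⟨ ∑-*ˡ (allV d) (+ p) (λ w → N w * g w) ⟨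
    ∑V (λ w → + p * (N w * g w))
      ≡⟨ ∑-cong (allV d) (λ w → lem (+ p) (N w) (g w) (#V d)) ⟩
    ∑V (λ w → (+ p * N w - #V d) * g w + #V d * g w)
      ≡⟨ ∑-+ (allV d) (λ w → (+ p * N w - #V d) * g w) (λ w → #V d * g w) ⟩
    ∑V (λ w → (+ p * N w - #V d) * g w) + ∑V (λ w → #V d * g w)
      ≡⟨ cong₂ _+_ (∑V-single (λ w → (+ p * N w - #V d) * g w) v others)
        (trans (∑-*ˡ (allV d) (#V d) g) (trans (cong (#V d *_) ∑g≡0) (ℤₚ.*-zeroʳ (#V d)))) ⟩
    (+ p * N v - #V d) * g v + 0ℤ
      ≡⟨ cong (λ t → (+ p * t - #V d) * g v + 0ℤ) diagonal ⟩
    (+ p * #V d - #V d) * g v + 0ℤ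
      ≡⟨ lem′ (+ p) (#V d) (g v) ⟩
    (+ p - 1ℤ) * #V d * g v ∎
    where
    open ≡-Reasoning
    diff : Vtx d → Vec ℤ d
    diff w = zipWith _-_ (coords w) (coords v)
    N : Vtx d → ℤ
    N w = ∑V (λ ξ → χ (dot ξ (diff w)))
    bilinear : ∀ ξ w → dot w (coords ξ) - dot v (coords ξ) ≡ dot ξ (diff w)
    bilinear ξ w = trans (cong₂ _-_ (dot-comm w ξ) (dot-comm v ξ)) (sym (dot-- ξ (coords w) (coords v)))
    lem : ∀ p n g m → p * (n * g) ≡ (p * n - m) * g + m * g
    lem = solve-∀
    lem′ : ∀ p m g → (p * m - m) * g + 0ℤ ≡ (p - 1ℤ) * m * g
    lem′ = solve-∀
    diagonal : N v ≡ #V d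
    diagonal = ∑-cong (allV d) λ ξ → χ≡1
      (divides 0ℤ (trans (dot-- ξ (coords v) (coords v)) (ℤₚ.+-inverseʳ (dot ξ (coords v)))))
    lookup-diff : ∀ w i → lookup (diff w) i ≡ toℤ (lookup w i) - toℤ (lookup v i)
    lookup-diff w i = trans (Vecₚ.lookup-zipWith _-_ i (coords w) (coords v))
      (cong₂ _-_ (Vecₚ.lookup-map i toℤ w) (Vecₚ.lookup-map i toℤ v))
    others : ∀ w → w ≢ v → (+ p * N w - #V d) * g w ≡ 0ℤ
    others w w≢v = trans (cong (λ t → (t - #V d) * g w)
      (hyperplane-size (diff w) i λ dv → wi≢vi (toℤ-injective (mod-p (subst (+ p ∣_) (lookup-diff w i) dv)))))
      (trans (cong (_* g w) (ℤₚ.+-inverseʳ (#V d))) (ℤₚ.*-zeroˡ (g w)))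
      where
      differ : Σ (Fin d) λ i → lookup w i ≢ lookup v i
      differ = Finₚ.¬∀⟶∃¬ d (λ i → lookup w i ≡ lookup v i) (λ i → lookup w i Finₚ.≟ lookup v i) (w≢v ∘ lookup-injective w v)
      i = proj₁ differ
      wi≢vi = proj₂ differ

  radon-scale : ∀ {d} (g : Vtx d → ℤ) ξ c e → e * c ≈ 1ℤ → radon g ξ c ≡ radon g (scale e ξ) 1ℤ
  radon-scale {d} g ξ c e inv = ∑-cong (allV d) λ v → cong (_* g v)
    (same (dot v (coords ξ)) (dot v (coords (scale e ξ))) (dot-scale e v ξ))
    where
    lem : ∀ e s c → s ≡ (1ℤ - e * c) * s + c * (e * s)
    lem = solve-∀
    lem′ : ∀ s c → 0ℤ * s + c * 1ℤ ≡ c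
    lem′ = solve-∀
    same : ∀ s t → t ≈ e * s → χ (s - c) ≡ χ (t - 1ℤ)
    same s t t≈es with + p ∣? (t - 1ℤ)
    ... | yes t≈1 = χ≡1 (≈⇒∣ (≈-trans (≈-reflexive (lem e s c)) (≈-trans
            (+-cong-≈ (*-congʳ-≈ s (≈-trans (+-cong-≈ (≈-refl {x = 1ℤ}) (neg-cong-≈ inv)) (≈-reflexive (ℤₚ.+-inverseʳ 1ℤ))))
                      (*-congˡ-≈ c (≈-trans (≈-sym t≈es) (mod-p t≈1)))) (≈-reflexive (lem′ s c)))))
    ... | no t≉1 = χ≡0 λ s≈c → t≉1 (≈⇒∣ (≈-trans t≈es (≈-trans (*-congˡ-≈ e (mod-p s≈c)) inv)))

  -- Signed permutations

  Covers : ∀ {d} → ℕ → Vtx d → Set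
  Covers {d} k ξ = ∀ c → 1 ℕ.≤ c → c ℕ.≤ k → Σ (Fin d) λ i → (toℤ (lookup ξ i) ≈ + c) ⊎ (toℤ (lookup ξ i) ≈ - + c)

  placements : ∀ k → Fin (suc k) → List (Vtx k) → List (Vtx (suc k))
  placements k i vs = map (λ v → insertAt v i (red (+ suc k))) vs ++ map (λ v → insertAt v i (red (- + suc k))) vs

  signedPerms : ∀ k → List (Vtx k)
  signedPerms zero    = [] ∷ []
  signedPerms (suc k) = concatMap (λ i → placements k i (signedPerms k)) (allFin (suc k))

  length-concatMap-const : ∀ {A B : Set} (f : A → List B) m → (∀ x → length (f x) ≡ m) → ∀ xs → length
    (concatMap f xs) ≡ length xs ℕ.* m
  length-concatMap-const f m e []       = refl
  length-concatMap-const f m e (x ∷ xs) = trans (length-++ (f x)) (cong₂ ℕ._+_ (e x) (length-concatMap-const f m e xs))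

  length-placements : ∀ k i vs → length (placements k i vs) ≡ length vs ℕ.+ length vs
  length-placements k i vs = trans (length-++ (map (λ v → insertAt v i (red (+ suc k))) vs))
    (cong₂ ℕ._+_ (length-map (λ v → insertAt v i (red (+ suc k))) vs) (length-map (λ v → insertAt v i (red (- + suc k))) vs))

  length-signedPerms : ∀ k → length (signedPerms k) ≡ k ! ℕ.* 2 ℕ.^ k
  length-signedPerms zero    = refl
  length-signedPerms (suc k) = begin
    length (signedPerms (suc k))                     ≡⟨ length-concatMap-const (λ i → placements k i (signedPerms k))
      (l ℕ.+ l)
                                                          (λ i → length-placements k i (signedPerms k)) (allFin (suc k)) ⟩
    length (allFin (suc k)) ℕ.* (l ℕ.+ l)            ≡⟨ cong₂ (λ a b → a ℕ.* (b ℕ.+ b))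
      (length-tabulate {n = suc k} (λ i → i)) (length-signedPerms k) ⟩
    suc k ℕ.* (k ! ℕ.* 2 ℕ.^ k ℕ.+ k ! ℕ.* 2 ℕ.^ k)  ≡⟨ lem (suc k) (k !) (2 ℕ.^ k) ⟩
    suc k ℕ.* k ! ℕ.* (2 ℕ.* 2 ℕ.^ k)                ∎
    where
    open ≡-Reasoning
    l = length (signedPerms k)
    lem : ∀ s f t → s ℕ.* (f ℕ.* t ℕ.+ f ℕ.* t) ≡ s ℕ.* f ℕ.* (2 ℕ.* t)
    lem = ℕ-Solver.solve-∀

  ±-disjoint : ∀ {x a b} → 0 ℕ.< b → b ℕ.< a → a ℕ.+ b ℕ.< p →
    (x ≈ + a) ⊎ (x ≈ - + a) → (x ≈ + b) ⊎ (x ≈ - + b) → ⊥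
  ±-disjoint {x} {a} {b} 0<b b<a a+b<p = cases
    where
    a<p : a ℕ.< p
    a<p = ℕₚ.≤-<-trans (ℕₚ.m≤m+n a b) a+b<p
    same : + a ≈ + b → ⊥
    same e = ℕₚ.<⇒≢ b<a (sym (small-≈⇒≡ a<p (ℕₚ.<-trans b<a a<p) e))
    opposite : + a ≈ - + b → ⊥
    opposite e = p∤small {a ℕ.+ b} (ℕₚ.<-≤-trans 0<b (ℕₚ.m≤n+m b a)) a+b<p
      (subst (+ p ∣_) (cong (_+_ (+ a)) (ℤₚ.neg-involutive (+ b))) (≈⇒∣ e))
    flip-≈ : ∀ {y z} → - y ≈ z → y ≈ - z
    flip-≈ {y} e = ≈-trans (≈-reflexive (sym (ℤₚ.neg-involutive y))) (neg-cong-≈ e)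
    cases : (x ≈ + a) ⊎ (x ≈ - + a) → (x ≈ + b) ⊎ (x ≈ - + b) → ⊥
    cases (inj₁ e) (inj₁ f) = same (≈-trans (≈-sym e) f)
    cases (inj₁ e) (inj₂ f) = opposite (≈-trans (≈-sym e) f)
    cases (inj₂ e) (inj₁ f) = opposite (flip-≈ (≈-trans (≈-sym e) f))
    cases (inj₂ e) (inj₂ f) = same (≈-trans (flip-≈ (≈-trans (≈-sym e) f)) (≈-reflexive (ℤₚ.neg-involutive (+ b))))

  ∈-signedPerms : ∀ k → k ℕ.+ k ℕ.< p → (ξ : Vtx k) → Covers k ξ → ξ ∈ signedPerms k
  ∈-signedPerms zero    _  []  _   = here refl
  ∈-signedPerms (suc k) lt ξ   cov = ∈-concatMap⁺ (λ j → placements k j (signedPerms k))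
    (Any.map (λ { refl → placed (proj₂ top) }) (∈-allFin i))
    where
    top = cov (suc k) (ℕ.s≤s ℕ.z≤n) ℕₚ.≤-refl
    i = proj₁ top
    rest : Covers k (removeAt ξ i)
    rest c 1≤c c≤k = Fin.punchOut i≢j , subst (λ a → (toℤ a ≈ + c) ⊎ (toℤ a ≈ - + c)) (sym (Vecₚ.removeAt-punchOut ξ i≢j))
      (proj₂ found)
      where
      found = cov c 1≤c (ℕₚ.m≤n⇒m≤1+n c≤k)
      i≢j : i ≢ proj₁ found
      i≢j eq = ±-disjoint 1≤c (ℕ.s≤s c≤k) (ℕₚ.≤-<-trans (ℕₚ.+-monoʳ-≤ (suc k) (ℕₚ.m≤n⇒m≤1+n c≤k)) lt)
        (proj₂ top) (subst (λ j → (toℤ (lookup ξ j) ≈ + c) ⊎ (toℤ (lookup ξ j) ≈ - + c)) (sym eq) (proj₂ found))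
    rest∈ : removeAt ξ i ∈ signedPerms k
    rest∈ = ∈-signedPerms k (ℕₚ.≤-<-trans (ℕₚ.+-mono-≤ (ℕₚ.n≤1+n k) (ℕₚ.n≤1+n k)) lt) (removeAt ξ i) rest
    inserted : ∀ z → toℤ (lookup ξ i) ≈ z → insertAt (removeAt ξ i) i (red z) ≡ ξ
    inserted z e = trans (cong (insertAt (removeAt ξ i) i) (trans (red-cong (≈-sym e)) (red-toℤ (lookup ξ i))))
      (Vecₚ.insertAt-removeAt ξ i)
    placed : (toℤ (lookup ξ i) ≈ + suc k) ⊎ (toℤ (lookup ξ i) ≈ - + suc k) → ξ ∈ placements k i (signedPerms k)
    placed (inj₁ e) = ∈-++⁺ˡ (subst (_∈ map (λ v → insertAt v i (red (+ suc k))) (signedPerms k))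
      (inserted (+ suc k) e) (∈-map⁺ (λ v → insertAt v i (red (+ suc k))) rest∈))
    placed (inj₂ e) = ∈-++⁺ʳ (map (λ v → insertAt v i (red (+ suc k))) (signedPerms k))
      (subst (_∈ map (λ v → insertAt v i (red (- + suc k))) (signedPerms k))
        (inserted (- + suc k) e) (∈-map⁺ (λ v → insertAt v i (red (- + suc k))) rest∈))

  -- Support of the Radon transform

  weight : ∀ {d} → Vtx d → ℕ → ℤ
  weight {d} ξ a = χ (0ℤ - + a) + ∑ (allFin d) λ i → χ (toℤ (lookup ξ i) - + a) + χ (- toℤ (lookup ξ i) - + a)

  χ-periodic : ∀ z a → χ (z - + (a ℕ.+ p)) ≡ χ (z - + a)
  χ-periodic z a = χ-cong (mod-p (divides (- 1ℤ) (lem z (+ a) (+ p))))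
    where
    lem : ∀ z a p → (z - (a + p)) - (z - a) ≡ - 1ℤ * p
    lem = solve-∀

  weight-periodic : ∀ {d} (ξ : Vtx d) → Periodic (weight ξ)
  weight-periodic {d} ξ a = cong₂ _+_ (χ-periodic 0ℤ a)
    (∑-cong (allFin d) λ i → cong₂ _+_ (χ-periodic (toℤ (lookup ξ i)) a) (χ-periodic (- toℤ (lookup ξ i)) a))

  radon-periodic : ∀ {d} (g : Vtx d → ℤ) ξ → Periodic (λ a → radon g ξ (+ a))
  radon-periodic g ξ a = radon-cong g ξ {+ (a ℕ.+ p)} {+ a} (mod-p (divides 1ℤ (lem (+ a) (+ p))))
    where
    lem : ∀ a p → (a + p) - a ≡ 1ℤ * p
    lem = solve-∀

  Null : ∀ {d} → (Vtx d → ℤ) → Set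
  Null g = ∀ v → cover g v ≡ 0ℤ

  corr-weight : ∀ {d} (g : Vtx d → ℤ) → Null g → ∀ ξ c → corr (weight ξ) (λ a → radon g ξ (+ a)) c ≡ 0ℤ
  corr-weight {d} g null ξ c = begin
    ∑< p (λ a → weight ξ a * F (+ a))
      ≡⟨ ∑-cong (downFrom p) (λ a → trans
        (ℤₚ.*-distribʳ-+ (F (+ a)) (χ (0ℤ - + a)) (∑ (allFin d) λ i → χ (x i - + a) + χ (- x i - + a)))
           (cong (_+_ (χ (0ℤ - + a) * F (+ a)))
             (trans (sym (∑-*ʳ (allFin d) (F (+ a)) (λ i → χ (x i - + a) + χ (- x i - + a))))
             (∑-cong (allFin d) λ i → ℤₚ.*-distribʳ-+ (F (+ a)) (χ (x i - + a)) (χ (- x i - + a)))))) ⟩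
    ∑< p (λ a → χ (0ℤ - + a) * F (+ a) + ∑ (allFin d) (λ i → t a i))
      ≡⟨ trans (∑-+ (downFrom p) (λ a → χ (0ℤ - + a) * F (+ a)) (λ a → ∑ (allFin d) (λ i → t a i)))
           (cong₂ _+_ (∑<-χ F F-cong 0ℤ) (∑-swap (downFrom p) (allFin d) t)) ⟩
    F 0ℤ + ∑ (allFin d) (λ i → ∑< p (λ a → t a i))
      ≡⟨ cong₂ _+_ (cong (radon g ξ) (ℤₚ.+-identityʳ (+ c)))
        (∑-cong (allFin d) λ i → trans (∑-+ (downFrom p) (λ a → χ (x i - + a) * F (+ a)) (λ a → χ (- x i - + a) * F (+ a)))
           (cong₂ _+_ (∑<-χ F F-cong (x i)) (∑<-χ F F-cong (- x i)))) ⟩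
    radon g ξ (+ c) + ∑ (allFin d) (λ i → radon g ξ (+ c + x i) + radon g ξ (+ c - x i))
      ≡⟨ radon-cover g null ξ (+ c) ⟩
    0ℤ ∎
    where
    open ≡-Reasoning
    x : Fin d → ℤ
    x i = toℤ (lookup ξ i)
    F : ℤ → ℤ
    F z = radon g ξ (+ c + z)
    F-cong : ∀ {y z} → y ≈ z → F y ≡ F z
    F-cong {y} {z} e = radon-cong g ξ (+-cong-≈ (≈-refl {x = + c}) e)
    t : ℕ → Fin d → ℤ
    t a i = χ (x i - + a) * F (+ a) + χ (- x i - + a) * F (+ a)

  module Support (n : ℕ) (p≡1+2n : + p ≡ 1ℤ + + n * + 2) where

    ∑V-null : (g : Vtx n → ℤ) → Null g → ∑V g ≡ 0ℤ
    ∑V-null g null = p*x≡0⇒x≡0 (∑V g) (trans (cong (_* ∑V g) p≡1+2n) (trans (sym (∑V-cover g)) (∑-zero (allV n) null)))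

    p∤weight₀ : (ξ : Vtx n) (i : Fin n) → ¬ + p ∣ toℤ (lookup ξ i) → ¬ + p ∣ weight ξ 0
    p∤weight₀ ξ i ndiv d = contradiction (ℤₚ.≤-trans 1≤w (ℤₚ.≤-reflexive w≡0)) λ { (+≤+ ()) }
      where
      x : Fin n → ℤ
      x j = toℤ (lookup ξ j)
      t : Fin n → ℤ
      t j = χ (x j - 0ℤ) + χ (- x j - 0ℤ)
      T = ∑ (allFin n) t
      0≤t : ∀ j → 0ℤ ≤ t j
      0≤t j = ℤₚ.+-mono-≤ (0≤χ (x j - 0ℤ)) (0≤χ (- x j - 0ℤ))
      t≤2 : ∀ j → 0ℤ ≤ + 2 - t j
      t≤2 j = ℤₚ.i≤j⇒0≤j-i (ℤₚ.+-mono-≤ (χ≤1 (x j - 0ℤ)) (χ≤1 (- x j - 0ℤ)))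
      tᵢ≡0 : t i ≡ 0ℤ
      tᵢ≡0 = cong₂ _+_ (χ≡0 λ e → ndiv (≈0⇒∣ (mod-p e)))
                       (χ≡0 λ e → ndiv (≈0⇒∣ (≈-trans (≈-reflexive (sym (ℤₚ.neg-involutive (x i))))
                         (neg-cong-≈ (mod-p { - x i} {0ℤ} e)))))
      slack : ∑ (allFin n) (λ j → + 2 - t j) ≡ + n * + 2 - T
      slack = trans (∑-- (allFin n) (λ _ → + 2) t)
        (cong (_- T) (trans (∑-const (allFin n) (+ 2)) (cong (λ l → + l * + 2) (length-tabulate {n = n} (λ j → j)))))
      T<2n : T < + n * + 2
      T<2n = ℤₚ.≰⇒> λ 2n≤T → contradiction
        (trans (sym (∑≤0⇒≡0 (allFin n) t≤2 (ℤₚ.≤-trans (ℤₚ.≤-reflexive slack) (ℤₚ.i≤j⇒i-j≤0 2n≤T)) (∈-allFin i)))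
          (cong (_-_ (+ 2)) tᵢ≡0)) λ ()
      w≡1+T : weight ξ 0 ≡ 1ℤ + T
      w≡1+T = cong (_+ T) (χ≡1 {0ℤ - 0ℤ} (divides 0ℤ refl))
      1≤w : 1ℤ ≤ weight ξ 0
      1≤w = ℤₚ.≤-trans (ℤₚ.+-monoʳ-≤ 1ℤ (∑-nonneg (allFin n) 0≤t)) (ℤₚ.≤-reflexive (sym w≡1+T))
      w<p : weight ξ 0 < + p
      w<p = ℤₚ.≤-<-trans (ℤₚ.≤-reflexive w≡1+T) (ℤₚ.<-≤-trans (ℤₚ.+-monoʳ-< 1ℤ T<2n) (ℤₚ.≤-reflexive (sym p≡1+2n)))
      w≡0 : weight ξ 0 ≡ 0ℤ
      w≡0 = ∣x∣<p⇒≡0 (ℤₚ.drop‿+<+ (ℤₚ.≤-<-trans (ℤₚ.≤-reflexive (ℤₚ.0≤i⇒+∣i∣≡i (ℤₚ.≤-trans (+≤+ ℕ.z≤n) 1≤w))) w<p)) d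

    p≡1+n+n : p ≡ suc (n ℕ.+ n)
    p≡1+n+n = ℤₚ.+-injective (trans p≡1+2n (lem (+ n)))
      where
      lem : ∀ n → 1ℤ + n * + 2 ≡ 1ℤ + (n + n)
      lem = solve-∀

    2n<p : n ℕ.+ n ℕ.< p
    2n<p = ℕₚ.≤-reflexive (sym p≡1+n+n)

    nonconstant⇒covers : (g : Vtx n → ℤ) → Null g → ∀ ξ i → ¬ + p ∣ toℤ (lookup ξ i) →
      ¬ Constant (λ a → radon g ξ (+ a)) → Covers n ξ
    nonconstant⇒covers g null ξ i ndiv nonconst c 1≤c c≤n
      with Finₚ.any? (λ j → (+ p ∣? (toℤ (lookup ξ j) - + c)) ⊎-dec (+ p ∣? (toℤ (lookup ξ j) - - + c)))
    ... | yes (j , e) = j , [ inj₁ ∘ mod-p , inj₂ ∘ mod-p ]′ e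
    ... | no none = contradiction (≈0⇒∣ (≈-trans (≈-sym w≈w₀) (≈-reflexive w≡0))) (p∤weight₀ ξ i ndiv)
      where
      x : Fin n → ℤ
      x j = toℤ (lookup ξ j)
      H : ℕ → ℤ
      H a = radon g ξ (+ a)
      w≈w₀ : weight ξ c ≈ weight ξ 0
      w≈w₀ = Δ≈0⇒≈ (weight ξ) (corr-constant⇒≈ (weight ξ) H (weight-periodic ξ) (radon-periodic g ξ)
        (λ a → cong₂ _-_ (corr-weight g null ξ (suc a)) (corr-weight g null ξ a)) nonconst) c 0
      negate : ∀ j → + p ∣ - x j - + c → + p ∣ x j - - + c
      negate j e = subst (+ p ∣_) (lem (x j) (+ c)) (≈0⇒∣ (neg-cong-≈ (∣⇒≈0 e)))
        where
        lem : ∀ x c → - (- x - c) ≡ x - - c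
        lem = solve-∀
      c<p : c ℕ.< p
      c<p = ℕₚ.≤-<-trans (ℕₚ.≤-trans c≤n (ℕₚ.m≤m+n n n)) 2n<p
      w≡0 : weight ξ c ≡ 0ℤ
      w≡0 = cong₂ _+_ (χ≡0 λ e → p∤small 1≤c c<p (≈0⇒∣ (≈-sym (mod-p {0ℤ} {+ c} e))))
        (∑-zero (allFin n) λ j → cong₂ _+_ (χ≡0 λ e → none (j , inj₁ e)) (χ≡0 λ e → none (j , inj₂ (negate j e))))

    constant⇒zero : (g : Vtx n → ℤ) → Null g → ∀ ξ → Constant (λ a → radon g ξ (+ a)) → radon g ξ 1ℤ ≡ 0ℤ
    constant⇒zero g null ξ const = p*x≡0⇒x≡0 (H 1) (begin
      + p * H 1                      ≡⟨ cong (λ l → + l * H 1) (length-downFrom p) ⟨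
      + length (downFrom p) * H 1    ≡⟨ ∑-const (downFrom p) (H 1) ⟨
      ∑< p (λ _ → H 1)               ≡⟨ ∑-cong (downFrom p) (λ a → trans (flat 1) (sym (flat a))) ⟩
      ∑< p H                         ≡⟨ radon-total g ξ ⟩
      ∑V g                           ≡⟨ ∑V-null g null ⟩
      0ℤ                             ∎)
      where
      open ≡-Reasoning
      H : ℕ → ℤ
      H a = radon g ξ (+ a)
      flat : ∀ a → H a ≡ H 0
      flat a = trans (Δ-const⇒linear {H} {0ℤ} const a) (trans (cong (_+_ (H 0)) (ℤₚ.*-zeroʳ (+ a))) (ℤₚ.+-identityʳ (H 0)))

    dot-zero : ∀ {d} (v ξ : Vtx d) → (∀ i → + p ∣ toℤ (lookup ξ i)) → dot v (coords ξ) ≈ 0ℤ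
    dot-zero []      []      e = ≈-refl
    dot-zero (a ∷ v) (b ∷ ξ) e = ≈-trans (+-cong-≈ (*-congˡ-≈ (toℤ a) (∣⇒≈0 (e Fin.zero))) (dot-zero v ξ (e ∘ Fin.suc)))
      (≈-reflexive (cong (_+ 0ℤ) (ℤₚ.*-zeroʳ (toℤ a))))

    p∤1 : ¬ + p ∣ 1ℤ
    p∤1 = p∤small {1} (ℕ.s≤s ℕ.z≤n) (ℕ.nonTrivial⇒n>1 p {{prime⇒nonTrivial p-prime}})

    radon-support : (g : Vtx n → ℤ) → Null g → ∀ ξ → ¬ ξ ∈ signedPerms n → radon g ξ 1ℤ ≡ 0ℤ
    radon-support g null ξ ξ∉ with Finₚ.any? (λ i → ¬? (+ p ∣? toℤ (lookup ξ i)))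
    ... | yes (i , ndiv) = decidable-stable (radon g ξ 1ℤ ℤₚ.≟ 0ℤ) λ r≢0 →
            ξ∉ (∈-signedPerms n 2n<p ξ (nonconstant⇒covers g null ξ i ndiv (r≢0 ∘ constant⇒zero g null ξ)))
    ... | no none = ∑-zero (allV n) λ v → trans
      (cong (_* g v) (χ≡0 λ e → p∤1 (≈0⇒∣ (≈-trans (≈-sym (mod-p e)) (dot-zero v ξ allZero))))) (ℤₚ.*-zeroˡ (g v))
      where
      allZero : ∀ i → + p ∣ toℤ (lookup ξ i)
      allZero i = decidable-stable (+ p ∣? toℤ (lookup ξ i)) λ nd → none (i , nd)

    spectrum : (Vtx n → ℤ) → Vec ℤ (length (signedPerms n))
    spectrum g = Vec.map (λ η → radon g η 1ℤ) (Vec.fromList (signedPerms n))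

    Linear : ((Vtx n → ℤ) → ℤ) → Set
    Linear φ = Σ (Vec ℤ (length (signedPerms n))) λ r → ∀ g → Null g → φ g ≡ r · spectrum g

    linear-cong : ∀ {φ ψ} → (∀ g → Null g → φ g ≡ ψ g) → Linear ψ → Linear φ
    linear-cong e (r , eq) = r , λ g null → trans (e g null) (eq g null)

    linear-combine : ∀ a b {φ ψ} → Linear φ → Linear ψ → Linear (λ g → a * φ g + b * ψ g)
    linear-combine a b (r , er) (s , es) = zipWith (λ t u → a * t + b * u) r s , λ g null →
      trans (cong₂ (λ t u → a * t + b * u) (er g null) (es g null)) (sym (·-combine a b r s (spectrum g)))

    linear-zero : Linear (λ _ → 0ℤ)
    linear-zero = Vec.replicate (length (signedPerms n)) 0ℤ , λ g _ → sym (·-zeroˡ (spectrum g))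

    linear-* : ∀ a {φ} → Linear φ → Linear (λ g → a * φ g)
    linear-* a {φ} l = linear-cong (λ g _ → sym (ℤₚ.+-identityʳ (a * φ g)))
      (linear-combine a 0ℤ {φ} {λ _ → 0ℤ} l linear-zero)

    linear-∑ : ∀ {A : Set} (xs : List A) (φ : A → (Vtx n → ℤ) → ℤ) → (∀ x → x ∈ xs → Linear (φ x)) → Linear
      (λ g → ∑ xs (λ x → φ x g))
    linear-∑ []       φ l = linear-zero
    linear-∑ (x ∷ xs) φ l = linear-cong
      (λ g _ → sym (cong₂ _+_ (ℤₚ.*-identityˡ (φ x g)) (ℤₚ.*-identityˡ (∑ xs λ y → φ y g))))
      (linear-combine 1ℤ 1ℤ {φ x} {λ g → ∑ xs (λ y → φ y g)} (l x (here refl)) (linear-∑ xs φ λ y → l y ∘ there))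

    linear-radon-1 : ∀ η → Linear (λ g → radon g η 1ℤ)
    linear-radon-1 η with DecMembership._∈?_ (Vecₚ.≡-dec Finₚ._≟_) η (signedPerms n)
    ... | yes η∈ = basis η∈ , λ g _ → sym (·-basis (λ ζ → radon g ζ 1ℤ) η∈)
    ... | no  η∉ = linear-cong (λ g null → radon-support g null η η∉) linear-zero

    linear-radon-unit : ∀ ξ c → ¬ + p ∣ c → Linear (λ g → radon g ξ c)
    linear-radon-unit ξ c nd = linear-cong (λ g _ → radon-scale g ξ c (proj₁ e) (proj₂ e))
      (linear-radon-1 (scale (proj₁ e) ξ))
      where e = inverse c nd

    linear-radon-0 : ∀ ξ → Linear (λ g → radon g ξ 0ℤ)
    linear-radon-0 ξ = linear-cong eq (linear-* (- 1ℤ) {λ g → ∑< q (λ a → radon g ξ (+ suc a))}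
      (linear-∑ (downFrom q) (λ a g → radon g ξ (+ suc a)) λ a a∈ → linear-radon-unit ξ (+ suc a)
        (p∤small (ℕ.s≤s ℕ.z≤n) (subst (suc a ℕ.<_) (ℕₚ.suc-pred p) (ℕ.s≤s (∈-downFrom⁻ a∈))))))
      where
      q = ℕ.pred p
      eq : ∀ g → Null g → radon g ξ 0ℤ ≡ - 1ℤ * ∑< q (λ a → radon g ξ (+ suc a))
      eq g null = trans (lem (radon g ξ 0ℤ) (∑< q (λ a → radon g ξ (+ suc a))))
        (trans (cong (λ t → - 1ℤ * ∑< q (λ a → radon g ξ (+ suc a)) + t)
          (trans (∑<-suc q (λ a → radon g ξ (+ a)))
            (trans (cong (λ m → ∑< m (λ a → radon g ξ (+ a))) (ℕₚ.suc-pred p)) (trans (radon-total g ξ) (∑V-null g null)))))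
          (ℤₚ.+-identityʳ (- 1ℤ * ∑< q (λ a → radon g ξ (+ suc a)))))
        where
        lem : ∀ h s → h ≡ - 1ℤ * s + (s + h)
        lem = solve-∀

    linear-radon : ∀ ξ c → Linear (λ g → radon g ξ c)
    linear-radon ξ c with + p ∣? c
    ... | yes d = linear-cong (λ g _ → radon-cong g ξ (∣⇒≈0 d)) (linear-radon-0 ξ)
    ... | no nd = linear-radon-unit ξ c nd

    linear-eval : ∀ v → Linear (λ g → (+ p - 1ℤ) * #V n * g v)
    linear-eval v = linear-cong (λ g null → sym (radon-inversion g (∑V-null g null) v))
      (linear-* (+ p) {λ g → ∑V (λ ξ → radon g ξ (dot v (coords ξ)))}
        (linear-∑ (allV n) (λ ξ g → radon g ξ (dot v (coords ξ))) λ ξ _ → linear-radon ξ (dot v (coords ξ))))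

    eval-scale-cancel : ∀ x → (+ p - 1ℤ) * #V n * x ≡ 0ℤ → x ≡ 0ℤ
    eval-scale-cancel x e = [ (λ c≡0 → contradiction c≡0 c≢0) , (λ x≡0 → x≡0) ]′ (ℤₚ.i*j≡0⇒i≡0∨j≡0 ((+ p - 1ℤ) * #V n) e)
      where
      c≢0 : (+ p - 1ℤ) * #V n ≢ 0ℤ
      c≢0 eq = [ (λ p-1≡0 → p∤1 (divides 1ℤ (sym (trans (ℤₚ.*-identityˡ (+ p)) (ℤₚ.i-j≡0⇒i≡j (+ p) 1ℤ p-1≡0))))) , #V≢0 n ]′
        (ℤₚ.i*j≡0⇒i≡0∨j≡0 (+ p - 1ℤ) eq)

    determining-set : (S : List (Vtx n)) → Σ (List (Vtx n)) λ D → (∀ {v} → v ∈ D → v ∈ S) × length D ℕ.≤ n ! ℕ.* 2 ℕ.^ n ×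
      (∀ g → Null g → (∀ {v} → v ∈ D → g v ≡ 0ℤ) → ∀ {v} → v ∈ S → g v ≡ 0ℤ)
    determining-set S = rows , rows⊆ , ℕₚ.≤-trans #rows≤ (ℕₚ.≤-reflexive (length-signedPerms n)) , λ g null vanish {v} v∈ →
        eval-scale-cancel (g v) (trans (proj₂ (linear-eval v) g null) (spans (spectrum g) (λ {d} d∈ →
          trans (sym (proj₂ (linear-eval d) g null))
            (trans (cong ((+ p - 1ℤ) * #V n *_) (vanish d∈)) (ℤₚ.*-zeroʳ ((+ p - 1ℤ) * #V n)))) v∈))
      where
      open SpanningRows (spanning-rows (length (signedPerms n)) S λ v → proj₁ (linear-eval v))

  -- Dominating sets

  _≟ᵥ_ : ∀ {d} → DecidableEquality (Vtx d)
  _≟ᵥ_ = Vecₚ.≡-dec Finₚ._≟_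

  δ : ∀ {d} → Vtx d → Vtx d → ℤ
  δ s v with s ≟ᵥ v
  ... | yes _ = 1ℤ
  ... | no  _ = 0ℤ

  δ≡1 : ∀ {d} (v : Vtx d) → δ v v ≡ 1ℤ
  δ≡1 v with v ≟ᵥ v
  ... | yes _  = refl
  ... | no v≢v = contradiction refl v≢v

  δ≡0 : ∀ {d} {s v : Vtx d} → s ≢ v → δ s v ≡ 0ℤ
  δ≡0 {_} {s} {v} s≢v with s ≟ᵥ v
  ... | yes e = contradiction e s≢v
  ... | no _  = refl

  0≤δ : ∀ {d} (s v : Vtx d) → 0ℤ ≤ δ s v
  0≤δ s v with s ≟ᵥ v
  ... | yes _ = +≤+ ℕ.z≤n
  ... | no  _ = +≤+ ℕ.z≤n

  mult : ∀ {d} → List (Vtx d) → Vtx d → ℤ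
  mult S v = ∑ S λ s → δ s v

  0≤mult : ∀ {d} (S : List (Vtx d)) v → 0ℤ ≤ mult S v
  0≤mult S v = ∑-nonneg S λ s → 0≤δ s v

  ∈⇒1≤mult : ∀ {d} (S : List (Vtx d)) {v} → v ∈ S → 1ℤ ≤ mult S v
  ∈⇒1≤mult S {v} v∈ = ℤₚ.≤-trans (ℤₚ.≤-reflexive (sym (δ≡1 v))) (∑≥term S {λ s → δ s v} (λ s → 0≤δ s v) v∈)

  ∉⇒mult≡0 : ∀ {d} (S : List (Vtx d)) {v} → ¬ v ∈ S → mult S v ≡ 0ℤ
  ∉⇒mult≡0 S {v} v∉ = trans (∑-cong-∈ S λ s s∈ → δ≡0 λ { refl → v∉ s∈ }) (∑-zero S λ _ → refl)

  1≤mult⇒∈ : ∀ {d} (S : List (Vtx d)) {v} → 1ℤ ≤ mult S v → v ∈ S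
  1≤mult⇒∈ S {v} le = decidable-stable (DecMembership._∈?_ _≟ᵥ_ v S) λ v∉ →
    contradiction (subst (1ℤ ≤_) (∉⇒mult≡0 S v∉) le) λ { (+≤+ ()) }

  ∑V-mult : ∀ {d} (S : List (Vtx d)) → ∑V (mult S) ≡ + length S
  ∑V-mult {d} S = begin
    ∑V (mult S)                 ≡⟨ ∑-swap (allV d) S (λ v s → δ s v) ⟩
    ∑ S (λ s → ∑V (δ s))        ≡⟨ ∑-cong S (λ s → trans (∑V-single (δ s) s λ v v≢s → δ≡0 (v≢s ∘ sym)) (δ≡1 s)) ⟩
    ∑ S (λ _ → 1ℤ)              ≡⟨ ∑-const S 1ℤ ⟩
    + length S * 1ℤ             ≡⟨ ℤₚ.*-identityʳ (+ length S) ⟩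
    + length S                  ∎
    where open ≡-Reasoning

  suc[p∸1]≡p : suc (p ℕ.∸ 1) ≡ p
  suc[p∸1]≡p = ℕₚ.suc-pred p

  %-≈ : ∀ m .{{_ : ℕ.NonZero m}} → m ≡ p → ∀ a → + (a ℕ.% m) ≈ + a
  %-≈ m refl a = %ℕ-≈ (+ a)

  cycle-step⇒≈ : ∀ (a b : Fin p) → toℕ b ≡ (toℕ a ℕ.+ 1) ℕ.% suc (p ℕ.∸ 1) → toℤ b ≈ toℤ a + 1ℤ
  cycle-step⇒≈ a b e = ≈-trans (≈-reflexive (cong +_ e)) (%-≈ (suc (p ℕ.∸ 1)) suc[p∸1]≡p (toℕ a ℕ.+ 1))

  ≈⇒cycle-step : ∀ (a b : Fin p) → toℤ b ≈ toℤ a + 1ℤ → toℕ b ≡ (toℕ a ℕ.+ 1) ℕ.% suc (p ℕ.∸ 1)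
  ≈⇒cycle-step a b e = small-≈⇒≡ (Finₚ.toℕ<n b)
    (subst ((toℕ a ℕ.+ 1) ℕ.% suc (p ℕ.∸ 1) ℕ.<_) suc[p∸1]≡p (m%n<n (toℕ a ℕ.+ 1) (suc (p ℕ.∸ 1))))
    (≈-trans e (≈-sym (%-≈ (suc (p ℕ.∸ 1)) suc[p∸1]≡p (toℕ a ℕ.+ 1))))

  ≡shift : ∀ {d} k i (s v : Vtx d) → toℤ (lookup s i) ≈ toℤ (lookup v i) + k →
    (∀ j → j ≢ i → lookup s j ≡ lookup v j) → s ≡ shift k i v
  ≡shift k i s v e others = lookup-injective s (shift k i v) λ j → at j
    where
    at : ∀ j → lookup s j ≡ lookup (shift k i v) j
    at j with j Finₚ.≟ i
    ... | yes refl = trans (toℤ-injective (≈-trans e (≈-sym (toℤ-red (toℤ (lookup v i) + k)))))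
      (sym (Vecₚ.lookup∘updateAt i v))
    ... | no j≢i   = trans (others j j≢i) (sym (Vecₚ.lookup∘updateAt′ j i j≢i v))

  toℤ-shift : ∀ {d} k i (v : Vtx d) → toℤ (lookup (shift k i v) i) ≈ toℤ (lookup v i) + k
  toℤ-shift k i v = ≈-trans (≈-reflexive (cong toℤ (Vecₚ.lookup∘updateAt i v))) (toℤ-red (toℤ (lookup v i) + k))

  Adj⇒shift : ∀ {d} (s v : Vtx d) → Adj s v → Σ (Fin d) λ i → (s ≡ shift 1ℤ i v) ⊎ (s ≡ shift (- 1ℤ) i v)
  Adj⇒shift s v (i , inj₂ e , others) = i , inj₁ (≡shift 1ℤ i s v (cycle-step⇒≈ (lookup v i) (lookup s i) e) others)
  Adj⇒shift s v (i , inj₁ e , others) = i , inj₂ (≡shift (- 1ℤ) i s v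
    (≈-trans (≈-reflexive (lem (toℤ (lookup s i))))
      (+-cong-≈ (≈-sym (cycle-step⇒≈ (lookup s i) (lookup v i) e)) (≈-refl {x = - 1ℤ}))) others)
    where
    lem : ∀ a → a ≡ a + 1ℤ + - 1ℤ
    lem = solve-∀

  shift-Adj⁺ : ∀ {d} i (v : Vtx d) → Adj (shift 1ℤ i v) v
  shift-Adj⁺ i v = i , inj₂ (≈⇒cycle-step (lookup v i) (lookup (shift 1ℤ i v) i)
    (toℤ-shift 1ℤ i v)) , λ j j≢i → Vecₚ.lookup∘updateAt′ j i j≢i v

  shift-Adj⁻ : ∀ {d} i (v : Vtx d) → Adj (shift (- 1ℤ) i v) v
  shift-Adj⁻ i v = i , inj₁ (≈⇒cycle-step (lookup (shift (- 1ℤ) i v) i) (lookup v i)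
      (≈-trans (≈-reflexive (lem (toℤ (lookup v i)))) (+-cong-≈ (≈-sym (toℤ-shift (- 1ℤ) i v)) (≈-refl {x = 1ℤ}))))
    , λ j j≢i → Vecₚ.lookup∘updateAt′ j i j≢i v
    where
    lem : ∀ a → a ≡ a + - 1ℤ + 1ℤ
    lem = solve-∀

  module _ {d : ℕ} (f : Vtx d → ℤ) (0≤f : ∀ v → 0ℤ ≤ f v) (v : Vtx d) where

    private
      t : Fin d → ℤ
      t i = f (shift 1ℤ i v) + f (shift (- 1ℤ) i v)

      0≤t : ∀ i → 0ℤ ≤ t i
      0≤t i = ℤₚ.+-mono-≤ (0≤f (shift 1ℤ i v)) (0≤f (shift (- 1ℤ) i v))

      ≤+ : ∀ x y → 0ℤ ≤ y → x ≤ x + y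
      ≤+ x y 0≤y = ℤₚ.≤-trans (ℤₚ.≤-reflexive (sym (ℤₚ.+-identityʳ x))) (ℤₚ.+-monoʳ-≤ x 0≤y)

      ≤+ˡ : ∀ x y → 0ℤ ≤ y → x ≤ y + x
      ≤+ˡ x y 0≤y = ℤₚ.≤-trans (≤+ x y 0≤y) (ℤₚ.≤-reflexive (ℤₚ.+-comm x y))

      t≤cover : ∀ i → t i ≤ cover f v
      t≤cover i = ℤₚ.≤-trans (∑≥term (allFin d) 0≤t (∈-allFin i)) (≤+ˡ (∑ (allFin d) t) (f v) (0≤f v))

    centre≤cover : f v ≤ cover f v
    centre≤cover = ≤+ (f v) (∑ (allFin d) t) (∑-nonneg (allFin d) 0≤t)

    neighbour≤cover : ∀ s i → (s ≡ shift 1ℤ i v) ⊎ (s ≡ shift (- 1ℤ) i v) → f s ≤ cover f v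
    neighbour≤cover _ i (inj₁ refl) = ℤₚ.≤-trans (≤+ (f (shift 1ℤ i v)) (f (shift (- 1ℤ) i v)) (0≤f (shift (- 1ℤ) i v)))
      (t≤cover i)
    neighbour≤cover _ i (inj₂ refl) = ℤₚ.≤-trans (≤+ˡ (f (shift (- 1ℤ) i v)) (f (shift 1ℤ i v)) (0≤f (shift 1ℤ i v)))
      (t≤cover i)

  1≤cover-dominating : ∀ {d} (S : List (Vtx d)) → IsDominating p d S → ∀ v → 1ℤ ≤ cover (mult S) v
  1≤cover-dominating S (_ , dom) v with dom v
  ... | inj₁ v∈S = ℤₚ.≤-trans (∈⇒1≤mult S v∈S) (centre≤cover (mult S) (0≤mult S) v)
  ... | inj₂ (s , s∈S , adj) = ℤₚ.≤-trans (∈⇒1≤mult S s∈S)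
          (neighbour≤cover (mult S) (0≤mult S) v s (proj₁ (Adj⇒shift s v adj)) (proj₂ (Adj⇒shift s v adj)))

  length-filter-χ : ∀ {A : Set} (f : A → ℤ) xs → + length (filter (λ x → + p ∣? f x) xs) ≡ ∑ xs (λ x → χ (f x))
  length-filter-χ f [] = refl
  length-filter-χ f (x ∷ xs) = split (+ p ∣? f x)
    where
    split : Dec (+ p ∣ f x) → + length (filter (λ x → + p ∣? f x) (x ∷ xs)) ≡ ∑ (x ∷ xs) (λ x → χ (f x))
    split (yes d) = trans (cong (+_ ∘ length) (filter-accept (λ x → + p ∣? f x) d))
      (cong₂ _+_ (sym (χ≡1 d)) (length-filter-χ f xs))
    split (no nd) = trans (cong (+_ ∘ length) (filter-reject (λ x → + p ∣? f x) nd))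
      (trans (length-filter-χ f xs) (trans (sym (ℤₚ.+-identityˡ (∑ xs (λ x → χ (f x)))))
      (cong (_+ ∑ xs (λ x → χ (f x))) (sym (χ≡0 nd)))))

  cover-- : ∀ {d} (f g : Vtx d → ℤ) v → cover (λ w → f w - g w) v ≡ cover f v - cover g v
  cover-- {d} f g v = trans (cong (_+_ (f v - g v))
    (trans (∑-cong (allFin d) λ i → lem (f (shift 1ℤ i v)) (g (shift 1ℤ i v)) (f (shift (- 1ℤ) i v)) (g (shift (- 1ℤ) i v)))
      (∑-- (allFin d) (t f) (t g)))) (lem (f v) (g v) (∑ (allFin d) (t f)) (∑ (allFin d) (t g)))
    where
    t : (Vtx d → ℤ) → Fin d → ℤ
    t h i = h (shift 1ℤ i v) + h (shift (- 1ℤ) i v)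
    lem : ∀ a b c d → (a - b) + (c - d) ≡ (a + c) - (b + d)
    lem = solve-∀

  module Perfect (n : ℕ) (1≤n : 1 ℕ.≤ n) (p≡1+2n : + p ≡ 1ℤ + + n * + 2) where

    open Support n p≡1+2n

    label : Vec ℤ n
    label = Vec.tabulate λ i → + suc (toℕ i)

    lookup-label : ∀ {j} (j<n : j ℕ.< n) → lookup label (fromℕ< j<n) ≡ + suc j
    lookup-label j<n = trans (Vecₚ.lookup∘tabulate (λ i → + suc (toℕ i)) (fromℕ< j<n))
      (cong (λ a → + suc a) (Finₚ.toℕ-fromℕ< j<n))

    zeros : List (Vtx n)
    zeros = filter (λ v → + p ∣? dot v label) (allV n)

    code : List (Vtx n)
    code = deduplicate _≟ᵥ_ zeros

    ∈-code : ∀ {v} → dot v label ≈ 0ℤ → v ∈ code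
    ∈-code {v} e = ∈-deduplicate⁺ _≟ᵥ_ (∈-filter⁺ (λ w → + p ∣? dot w label) (∈-allV v) (≈0⇒∣ e))

    p*length-code : + p * + length code ≤ #V n
    p*length-code = ℤₚ.≤-trans (ℤₚ.*-monoˡ-≤-nonNeg (+ p) (+≤+ (length-deduplicate _≟ᵥ_ zeros)))
      (ℤₚ.≤-reflexive (trans (cong (+ p *_) (length-filter-χ (λ v → dot v label) (allV n)))
        (hyperplane-size label (fromℕ< 1≤n) λ d → p∤1 (subst (+ p ∣_) (lookup-label 1≤n) d))))

    code-dominating : IsDominating p n code
    code-dominating = DecUnique.deduplicate-! _≟ᵥ_ zeros , λ v → dominate v (dot v label %ℕ p) (n%ℕd<d (dot v label) p)
      (%ℕ-≈ (dot v label))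
      where
      shifted : ∀ v k {j} (j<n : j ℕ.< n) → dot v label + k * + suc j ≈ 0ℤ → shift k (fromℕ< j<n) v ∈ code
      shifted v k j<n e = ∈-code (≈-trans (dot-shift k (fromℕ< j<n) v label)
        (≈-trans (≈-reflexive (cong (λ t → dot v label + k * t) (lookup-label j<n))) e))
      dominate : ∀ v r → r ℕ.< p → + r ≈ dot v label → (v ∈ code) ⊎ (Σ (Vtx n) λ s → s ∈ code × Adj s v)
      dominate v zero    _   r≈ = inj₁ (∈-code (≈-sym r≈))
      dominate v (suc j) r<p r≈ with suc j ℕ.≤? n
      ... | yes j<n = inj₂ (shift (- 1ℤ) (fromℕ< j<n) v , shifted v (- 1ℤ) j<n
              (≈-trans (+-cong-≈ (≈-sym r≈) (≈-refl {x = - 1ℤ * + suc j})) (≈-reflexive (lem (+ suc j)))) , shift-Adj⁻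
                (fromℕ< j<n) v)
        where
        lem : ∀ a → a + - 1ℤ * a ≡ 0ℤ
        lem = solve-∀
      ... | no j≮n = inj₂ (shift 1ℤ (fromℕ< k<n) v , shifted v 1ℤ k<n
              (≈-trans (+-cong-≈ (≈-sym r≈) (≈-refl {x = 1ℤ * + suc k}))
                (∣⇒≈0 (divides 1ℤ (trans (cong (_+_ (+ suc j)) (ℤₚ.*-identityˡ (+ suc k)))
                (trans (cong +_ r+k≡p) (sym (ℤₚ.*-identityˡ (+ p)))))))) , shift-Adj⁺ (fromℕ< k<n) v)
        where
        k = p ℕ.∸ suc (suc j)
        r+k≡p : suc j ℕ.+ suc k ≡ p
        r+k≡p = trans (ℕₚ.+-suc (suc j) k) (ℕₚ.m+[n∸m]≡n r<p)
        k<n : k ℕ.< n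
        k<n = ℕₚ.+-cancelˡ-≤ (suc n) (suc k) n
          (ℕₚ.≤-trans (ℕₚ.+-monoˡ-≤ (suc k) (ℕₚ.≰⇒> j≮n)) (ℕₚ.≤-reflexive (trans r+k≡p p≡1+n+n)))

    cover≡1 : ∀ S → IsMinDominating p n S → ∀ v → cover (mult S) v ≡ 1ℤ
    cover≡1 S (dom , minimal) v = ℤₚ.i-j≡0⇒i≡j (cover (mult S) v) 1ℤ
      (∑≤0⇒≡0 (allV n) {λ w → cover (mult S) w - 1ℤ} (λ w → ℤₚ.i≤j⇒0≤j-i (1≤cover-dominating S dom w)) total (∈-allV v))
      where
      total : ∑V (λ w → cover (mult S) w - 1ℤ) ≤ 0ℤ
      total = ℤₚ.≤-trans (ℤₚ.≤-reflexive (trans (∑-- (allV n) (cover (mult S)) (λ _ → 1ℤ))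
          (cong (_- #V n) (trans (∑V-cover (mult S)) (cong₂ _*_ (sym p≡1+2n) (∑V-mult S))))))
        (ℤₚ.i≤j⇒i-j≤0 (ℤₚ.≤-trans (ℤₚ.*-monoˡ-≤-nonNeg (+ p) (+≤+ (minimal code code-dominating))) p*length-code))

    mult≡1 : ∀ S → IsMinDominating p n S → ∀ {v} → v ∈ S → mult S v ≡ 1ℤ
    mult≡1 S min {v} v∈ = ℤₚ.≤-antisym (ℤₚ.≤-trans (centre≤cover (mult S) (0≤mult S) v) (ℤₚ.≤-reflexive (cover≡1 S min v)))
      (∈⇒1≤mult S v∈)

    defining-set : (S : VSet p n) → IsMinDominating p n S →
      Σ (VSet p n) λ D → IsDefiningSet p n S D × length D ℕ.≤ n ! ℕ.* 2 ℕ.^ n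
    defining-set S S-min = D , (DecUnique.deduplicate-! _≟ᵥ_ D₀ , (λ v∈ → D₀⊆S (∈-deduplicate⁻ _≟ᵥ_ D₀ v∈)) , unique)
      , ℕₚ.≤-trans (length-deduplicate _≟ᵥ_ D₀) #D₀≤
      where
      determined = determining-set S
      D₀ = proj₁ determined
      D₀⊆S : ∀ {v} → v ∈ D₀ → v ∈ S
      D₀⊆S = proj₁ (proj₂ determined)
      #D₀≤ = proj₁ (proj₂ (proj₂ determined))
      D = deduplicate _≟ᵥ_ D₀
      unique : ∀ T → IsMinDominating p n T → D ⊆ᵥ T → T ≐ S
      unique T T-min D⊆T v = mk⇔
        (λ v∈T → 1≤mult⇒∈ S (subst (1ℤ ≤_) (agree v) (∈⇒1≤mult T v∈T)))
        (λ v∈S → 1≤mult⇒∈ T (subst (1ℤ ≤_) (sym (agree v)) (∈⇒1≤mult S v∈S)))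
        where
        g : Vtx n → ℤ
        g w = mult T w - mult S w
        g-null : Null g
        g-null w = trans (cover-- (mult T) (mult S) w) (cong₂ _-_ (cover≡1 T T-min w) (cover≡1 S S-min w))
        g-D₀ : ∀ {w} → w ∈ D₀ → g w ≡ 0ℤ
        g-D₀ w∈ = cong₂ _-_ (mult≡1 T T-min (D⊆T (∈-deduplicate⁺ _≟ᵥ_ w∈))) (mult≡1 S S-min (D₀⊆S w∈))
        g-S : ∀ {w} → w ∈ S → g w ≡ 0ℤ
        g-S = proj₂ (proj₂ (proj₂ determined)) g g-null g-D₀
        0≤g : ∀ w → 0ℤ ≤ g w
        0≤g w with DecMembership._∈?_ _≟ᵥ_ w S
        ... | yes w∈ = ℤₚ.≤-reflexive (sym (g-S w∈))
        ... | no w∉  = ℤₚ.i≤j⇒0≤j-i (ℤₚ.≤-trans (ℤₚ.≤-reflexive (∉⇒mult≡0 S w∉)) (0≤mult T w))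
        agree : ∀ w → mult T w ≡ mult S w
        agree w = ℤₚ.i-j≡0⇒i≡j (mult T w) (mult S w) (∑≤0⇒≡0 (allV n) 0≤g (ℤₚ.≤-reflexive (∑V-null g g-null)) (∈-allV w))

theorem2 : (n : ℕ) → 1 ℕ.≤ n → Prime (2 ℕ.* n ℕ.+ 1) →
    (S : VSet (2 ℕ.* n ℕ.+ 1) n) → IsMinDominating (2 ℕ.* n ℕ.+ 1) n S →
    Σ (VSet (2 ℕ.* n ℕ.+ 1) n) λ D →
    IsDefiningSet (2 ℕ.* n ℕ.+ 1) n S D × length D ℕ.≤ (n !) ℕ.* 2 ℕ.^ n
theorem2 n 1≤n p-prime = PrimeModulus.Perfect.defining-set (2 ℕ.* n ℕ.+ 1) p-prime n 1≤n
  (trans (cong +_ (lem n)) (cong (_+_ 1ℤ) (ℤₚ.pos-* n 2)))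
  where
  lem : ∀ n → 2 ℕ.* n ℕ.+ 1 ≡ 1 ℕ.+ n ℕ.* 2
  lem = ℕ-Solver.solve-∀
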